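{- Let $a$, $b$, and $n$ be positive integers. Then \[ \frac {1-q^{\gcd(an,bn+1)}} {1-q^{bn+1}}\begin{bmatrix} an+bn\\ an\end{bmatrix}_q =\frac {1-q^{\gcd(an,bn+1)}} {1-q^{an+bn+1}}\begin{bmatrix} an+bn+1\\ an\end{bmatrix}_q \] is a polynomial in $q$ with non-negative coefficients.
   Context: The $q$-binomial coefficients (Gaussian polynomials) are defined by $\begin{bmatrix} n\\ k\end{bmatrix}_q=\frac{(1-q^n)(1-q^{n-1})\cdots(1-q)}{(1-q^k)(1-q^{k-1})\cdots(1-q)(1-q^{n-k})(1-q^{n-k-1})\cdots(1-q)}$ if $0\le k\le n$, and $0$ otherwise. -}

module Defs where

open import Data.Nat as ℕ using (ℕ; zero; suc)
open import Data.Integer as ℤ using (ℤ; +_)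
open import Data.List using (List; []; _∷_; map; replicate; _++_)
open import Relation.Binary.PropositionalEquality using (_≡_)

-- Polynomials in q with integer coefficients, as coefficient lists
-- (constant term first). Trailing zeros are allowed; equality is
-- coefficientwise (_≈ₚ_).
Poly : Set
Poly = List ℤ

coeff : Poly → ℕ → ℤ
coeff []       _       = + 0
coeff (c ∷ p)  zero    = c
coeff (c ∷ p)  (suc i) = coeff p i

_≈ₚ_ : Poly → Poly → Set
p ≈ₚ r = ∀ i → coeff p i ≡ coeff r i

infixl 6 _+ₚ_ _-ₚ_
infixl 7 _*ₚ_
infix 4 _≈ₚ_

_+ₚ_ : Poly → Poly → Poly
[]      +ₚ r       = r
(c ∷ p) +ₚ []      = c ∷ p
(c ∷ p) +ₚ (d ∷ r) = (c ℤ.+ d) ∷ (p +ₚ r)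

negₚ : Poly → Poly
negₚ = map (λ x → ℤ.- x)

_-ₚ_ : Poly → Poly → Poly
p -ₚ r = p +ₚ negₚ r

_*ₚ_ : Poly → Poly → Poly
[]      *ₚ r = []
(c ∷ p) *ₚ r = map (c ℤ.*_) r +ₚ (+ 0 ∷ (p *ₚ r))

oneₚ : Poly
oneₚ = + 1 ∷ []

qpow : ℕ → Poly
qpow k = replicate k (+ 0) ++ (+ 1 ∷ [])

1-q^ : ℕ → Poly
1-q^ k = oneₚ -ₚ qpow k

qPoch : ℕ → Poly
qPoch zero    = oneₚ
qPoch (suc m) = 1-q^ (suc m) *ₚ qPoch m

fromℕPoly : List ℕ → Poly
fromℕPoly = map +_

{-# OPTIONS --safe #-}
module Submission where

-- Put N = an + bn + 1 and g = gcd (an, bn + 1), and let G be the Gaussian polynomial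
-- [N; an]. Since 1 - q^N divides (1 - q^N) G and (1 - q^(bn+1)) G, it divides
-- (1 - q^g) G, say (1 - q^g) G = (1 - q^N) Q. The coefficients of G increase up to the middle
-- degree and decrease afterwards, so those of (1 - q^g) G are ≥ 0 in the first half and ≤ 0
-- late in the second; the recurrence Q_i = Q_(i-N) + G_i - G_(i-g), read forwards from 0 in the
-- first half and backwards from infinity in the second, gives Q_i ≥ 0.
--
-- Unimodality of G is proved by sl₂: on functions on 0/1-words with fixed numbers of letters,
-- the operators exchanging adjacent letters satisfy [raise, lower] = 2 rank - zeros * ones, which
-- makes raise injective below the middle rank and lower injective above it.

open import Defs
open import Algebra.Bundles using (CommutativeRing)
open import Data.Bool using (Bool; true; false; not)
import Data.Bool.Properties as Bool
open import Data.Fin using (zero; suc)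
open import Data.Integer as ℤ using (ℤ; +_)
import Data.Integer.Properties as ℤ
open import Data.Integer.Tactic.RingSolver using (solve-∀)
open import Data.List as List using (List; []; _∷_; map; replicate; _++_; length)
open import Data.List.Membership.Propositional using (_∈_; _∉_; find)
open import Data.List.Membership.Propositional.Properties
  using (∈-∃++; ∈-lookup; ∈-map⁺; ∈-map⁻; ∈-++⁺ˡ; ∈-++⁺ʳ; ∈-++⁻)
import Data.List.Properties as List
open import Data.List.Relation.Unary.All as All using (All; []; _∷_)
import Data.List.Relation.Unary.All.Properties as All
open import Data.List.Relation.Unary.Any using (here; there; any?)
open import Data.List.Relation.Unary.Unique.Propositional using (Unique; []; _∷_)
import Data.List.Relation.Unary.Unique.Propositional.Properties as Unique
open import Data.Nat as ℕ using (ℕ; zero; suc)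
open import Data.Nat.Divisibility using (∣⇒≤)
open import Data.Nat.GCD using (gcd; gcd-GCD; gcd[m,n]∣n; module Bézout)
open import Data.Nat.Induction using (<-rec)
import Data.Nat.Properties as ℕ
import Data.Nat.Tactic.RingSolver as ℕ-Solver
open import Data.Product using (Σ; ∃; _×_; _,_; proj₁; proj₂)
open import Data.Sum using (inj₁; inj₂; _⊎_)
open import Data.Vec as Vec using (Vec; []; _∷_)
import Data.Vec.Properties as Vec
open import Function using (_∘_)
open import Level using (0ℓ)
open import Relation.Binary.PropositionalEquality
open import Relation.Nullary using (Dec; yes; no; contradiction; ¬_; ¬?)
open import Relation.Nullary.Decidable using (decidable-stable)

-- The ring of polynomials

-- Functions on words of length N with k ones form the k-th exterior power of the N-dimensional
-- irreducible representation of sl₂: the places of the ones name the basis vectors in a wedge, and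
-- moving a basis vector to its neighbour exchanges two adjacent letters. No signs occur, because a
-- move onto an occupied place gives zero and every other move keeps the order. The rank of a word
-- is, up to an affine change, its sl₂-weight, so injectivity of an operator between neighbouring
-- ranks compares neighbouring coefficients of G. Injectivity becomes an inequality of counts
-- through elimination without division, so that ℤ is enough. The two readings of the recurrence
-- meet at degree an(bn+1)/2, half the degree of G. The backward reading of Q_j involves G only in
-- degrees N+j and N+j-g; both are at least j because g ≤ N, so every j past the middle is covered.
-- Fractions are cleared throughout, and 1 - q^m is cancelled for positive m only.

coeff-+ : ∀ p r i → coeff (p +ₚ r) i ≡ coeff p i ℤ.+ coeff r i
coeff-+ []      r       i       = sym (ℤ.+-identityˡ _)
coeff-+ (c ∷ p) []      i       = sym (ℤ.+-identityʳ _)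
coeff-+ (c ∷ p) (d ∷ r) zero    = refl
coeff-+ (c ∷ p) (d ∷ r) (suc i) = coeff-+ p r i

coeff-neg : ∀ p i → coeff (negₚ p) i ≡ ℤ.- coeff p i
coeff-neg []      i       = refl
coeff-neg (c ∷ p) zero    = refl
coeff-neg (c ∷ p) (suc i) = coeff-neg p i

coeff-scale : ∀ c p i → coeff (map (c ℤ.*_) p) i ≡ c ℤ.* coeff p i
coeff-scale c []      i       = sym (ℤ.*-zeroʳ c)
coeff-scale c (d ∷ p) zero    = refl
coeff-scale c (d ∷ p) (suc i) = coeff-scale c p i

coeff-*-zero : ∀ c p r → coeff ((c ∷ p) *ₚ r) 0 ≡ c ℤ.* coeff r 0
coeff-*-zero c p r = trans (coeff-+ (map (c ℤ.*_) r) _ 0)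
  (trans (ℤ.+-identityʳ _) (coeff-scale c r 0))

coeff-*-suc : ∀ c p r i →
  coeff ((c ∷ p) *ₚ r) (suc i) ≡ c ℤ.* coeff r (suc i) ℤ.+ coeff (p *ₚ r) i
coeff-*-suc c p r i = trans (coeff-+ (map (c ℤ.*_) r) _ (suc i))
  (cong (ℤ._+ _) (coeff-scale c r (suc i)))

*ₚ-congˡ : ∀ p {r s} → r ≈ₚ s → p *ₚ r ≈ₚ p *ₚ s
*ₚ-congˡ []      e i = refl
*ₚ-congˡ (c ∷ p) {r} {s} e zero = begin
  coeff ((c ∷ p) *ₚ r) 0  ≡⟨ coeff-*-zero c p r ⟩
  c ℤ.* coeff r 0         ≡⟨ cong (c ℤ.*_) (e 0) ⟩
  c ℤ.* coeff s 0         ≡⟨ coeff-*-zero c p s ⟨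
  coeff ((c ∷ p) *ₚ s) 0  ∎
  where open ≡-Reasoning
*ₚ-congˡ (c ∷ p) {r} {s} e (suc i) = begin
  coeff ((c ∷ p) *ₚ r) (suc i)                  ≡⟨ coeff-*-suc c p r i ⟩
  c ℤ.* coeff r (suc i) ℤ.+ coeff (p *ₚ r) i    ≡⟨ cong₂ (λ x y → c ℤ.* x ℤ.+ y) (e (suc i)) (*ₚ-congˡ p e i) ⟩
  c ℤ.* coeff s (suc i) ℤ.+ coeff (p *ₚ s) i    ≡⟨ coeff-*-suc c p s i ⟨
  coeff ((c ∷ p) *ₚ s) (suc i)                  ∎
  where open ≡-Reasoning

*ₚ-zeroʳ : ∀ p → p *ₚ [] ≈ₚ []
*ₚ-zeroʳ []      i       = refl
*ₚ-zeroʳ (c ∷ p) zero    = refl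
*ₚ-zeroʳ (c ∷ p) (suc i) = *ₚ-zeroʳ p i

coeff-*-∷ʳ-zero : ∀ p d r → coeff (p *ₚ (d ∷ r)) 0 ≡ d ℤ.* coeff p 0
coeff-*-∷ʳ-zero []      d r = sym (ℤ.*-zeroʳ d)
coeff-*-∷ʳ-zero (c ∷ p) d r = trans (coeff-*-zero c p (d ∷ r)) (ℤ.*-comm c d)

-- `_*ₚ_` recurses on its left factor; this is the mirror recursion on the right factor, and
-- matching the two proves commutativity.
coeff-*-∷ʳ-suc : ∀ p d r i →
  coeff (p *ₚ (d ∷ r)) (suc i) ≡ d ℤ.* coeff p (suc i) ℤ.+ coeff (p *ₚ r) i
coeff-*-∷ʳ-suc []      d r i = sym (trans (ℤ.+-identityʳ _) (ℤ.*-zeroʳ d))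
coeff-*-∷ʳ-suc (c ∷ p) d r zero = begin
  coeff ((c ∷ p) *ₚ (d ∷ r)) 1                    ≡⟨ coeff-*-suc c p (d ∷ r) 0 ⟩
  c ℤ.* coeff r 0 ℤ.+ coeff (p *ₚ (d ∷ r)) 0      ≡⟨ cong₂ ℤ._+_ (coeff-*-zero c p r) (sym (coeff-*-∷ʳ-zero p d r)) ⟨
  coeff ((c ∷ p) *ₚ r) 0 ℤ.+ d ℤ.* coeff p 0      ≡⟨ ℤ.+-comm (coeff ((c ∷ p) *ₚ r) 0) _ ⟩
  d ℤ.* coeff p 0 ℤ.+ coeff ((c ∷ p) *ₚ r) 0      ∎
  where open ≡-Reasoning
coeff-*-∷ʳ-suc (c ∷ p) d r (suc i) = begin
  coeff ((c ∷ p) *ₚ (d ∷ r)) (suc (suc i))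
    ≡⟨ coeff-*-suc c p (d ∷ r) (suc i) ⟩
  c ℤ.* coeff r (suc i) ℤ.+ coeff (p *ₚ (d ∷ r)) (suc i)
    ≡⟨ cong (λ x → c ℤ.* coeff r (suc i) ℤ.+ x) (coeff-*-∷ʳ-suc p d r i) ⟩
  c ℤ.* coeff r (suc i) ℤ.+ (d ℤ.* coeff p (suc i) ℤ.+ coeff (p *ₚ r) i)
    ≡⟨ exch (c ℤ.* coeff r (suc i)) (d ℤ.* coeff p (suc i)) (coeff (p *ₚ r) i) ⟩
  d ℤ.* coeff p (suc i) ℤ.+ (c ℤ.* coeff r (suc i) ℤ.+ coeff (p *ₚ r) i)
    ≡⟨ cong (λ x → d ℤ.* coeff p (suc i) ℤ.+ x) (coeff-*-suc c p r i) ⟨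
  d ℤ.* coeff p (suc i) ℤ.+ coeff ((c ∷ p) *ₚ r) (suc i) ∎
  where
  open ≡-Reasoning
  exch : ∀ x y z → x ℤ.+ (y ℤ.+ z) ≡ y ℤ.+ (x ℤ.+ z)
  exch = solve-∀

*ₚ-comm : ∀ p r → p *ₚ r ≈ₚ r *ₚ p
*ₚ-comm []      r i       = sym (*ₚ-zeroʳ r i)
*ₚ-comm (c ∷ p) r zero    = trans (coeff-*-zero c p r) (sym (coeff-*-∷ʳ-zero r c p))
*ₚ-comm (c ∷ p) r (suc i) = trans (coeff-*-suc c p r i)
  (trans (cong (λ x → c ℤ.* coeff r (suc i) ℤ.+ x) (*ₚ-comm p r i))
         (sym (coeff-*-∷ʳ-suc r c p i)))

-- Equal polynomials can be lists of different lengths, which blocks a simultaneous recursion on `p`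
-- and `p′`. Commutativity transfers the congruence from the right factor to the left one.
*ₚ-cong : ∀ {p p′ r r′} → p ≈ₚ p′ → r ≈ₚ r′ → p *ₚ r ≈ₚ p′ *ₚ r′
*ₚ-cong {p} {p′} {r} {r′} e f i = trans (*ₚ-congˡ p f i)
  (trans (*ₚ-comm p r′ i) (trans (*ₚ-congˡ r′ e i) (*ₚ-comm r′ p′ i)))

+ₚ-cong : ∀ {p p′ r r′} → p ≈ₚ p′ → r ≈ₚ r′ → p +ₚ r ≈ₚ p′ +ₚ r′
+ₚ-cong {p} {p′} {r} {r′} e f i = trans (coeff-+ p r i)
  (trans (cong₂ ℤ._+_ (e i) (f i)) (sym (coeff-+ p′ r′ i)))

*ₚ-distribˡ : ∀ p r s → p *ₚ (r +ₚ s) ≈ₚ p *ₚ r +ₚ p *ₚ s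
*ₚ-distribˡ []      r s i    = refl
*ₚ-distribˡ (c ∷ p) r s zero = begin
  coeff ((c ∷ p) *ₚ (r +ₚ s)) 0                         ≡⟨ coeff-*-zero c p (r +ₚ s) ⟩
  c ℤ.* coeff (r +ₚ s) 0                                ≡⟨ cong (c ℤ.*_) (coeff-+ r s 0) ⟩
  c ℤ.* (coeff r 0 ℤ.+ coeff s 0)                       ≡⟨ ℤ.*-distribˡ-+ c _ _ ⟩
  c ℤ.* coeff r 0 ℤ.+ c ℤ.* coeff s 0                   ≡⟨ cong₂ ℤ._+_ (coeff-*-zero c p r) (coeff-*-zero c p s) ⟨
  coeff ((c ∷ p) *ₚ r) 0 ℤ.+ coeff ((c ∷ p) *ₚ s) 0     ≡⟨ coeff-+ ((c ∷ p) *ₚ r) _ 0 ⟨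
  coeff ((c ∷ p) *ₚ r +ₚ (c ∷ p) *ₚ s) 0                ∎
  where open ≡-Reasoning
*ₚ-distribˡ (c ∷ p) r s (suc i) = begin
  coeff ((c ∷ p) *ₚ (r +ₚ s)) (suc i)
    ≡⟨ coeff-*-suc c p (r +ₚ s) i ⟩
  c ℤ.* coeff (r +ₚ s) (suc i) ℤ.+ coeff (p *ₚ (r +ₚ s)) i
    ≡⟨ cong₂ (λ x y → c ℤ.* x ℤ.+ y) (coeff-+ r s (suc i))
         (trans (*ₚ-distribˡ p r s i) (coeff-+ (p *ₚ r) (p *ₚ s) i)) ⟩
  c ℤ.* (coeff r (suc i) ℤ.+ coeff s (suc i)) ℤ.+ (coeff (p *ₚ r) i ℤ.+ coeff (p *ₚ s) i)
    ≡⟨ exch c (coeff r (suc i)) (coeff s (suc i)) (coeff (p *ₚ r) i) (coeff (p *ₚ s) i) ⟩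
  (c ℤ.* coeff r (suc i) ℤ.+ coeff (p *ₚ r) i) ℤ.+ (c ℤ.* coeff s (suc i) ℤ.+ coeff (p *ₚ s) i)
    ≡⟨ cong₂ ℤ._+_ (coeff-*-suc c p r i) (coeff-*-suc c p s i) ⟨
  coeff ((c ∷ p) *ₚ r) (suc i) ℤ.+ coeff ((c ∷ p) *ₚ s) (suc i)
    ≡⟨ coeff-+ ((c ∷ p) *ₚ r) _ (suc i) ⟨
  coeff ((c ∷ p) *ₚ r +ₚ (c ∷ p) *ₚ s) (suc i) ∎
  where
  open ≡-Reasoning
  exch : ∀ c x y u v → c ℤ.* (x ℤ.+ y) ℤ.+ (u ℤ.+ v) ≡ (c ℤ.* x ℤ.+ u) ℤ.+ (c ℤ.* y ℤ.+ v)
  exch = solve-∀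

*ₚ-distribʳ : ∀ s p r → (p +ₚ r) *ₚ s ≈ₚ p *ₚ s +ₚ r *ₚ s
*ₚ-distribʳ s p r i = trans (*ₚ-comm (p +ₚ r) s i) (trans (*ₚ-distribˡ s p r i)
  (+ₚ-cong {s *ₚ p} {p *ₚ s} {s *ₚ r} {r *ₚ s} (*ₚ-comm s p) (*ₚ-comm s r) i))

scale-*ₚ : ∀ c p r i → coeff (map (c ℤ.*_) p *ₚ r) i ≡ c ℤ.* coeff (p *ₚ r) i
scale-*ₚ c []      r i    = sym (ℤ.*-zeroʳ c)
scale-*ₚ c (d ∷ p) r zero = begin
  coeff ((c ℤ.* d ∷ map (c ℤ.*_) p) *ₚ r) 0  ≡⟨ coeff-*-zero (c ℤ.* d) (map (c ℤ.*_) p) r ⟩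
  c ℤ.* d ℤ.* coeff r 0                      ≡⟨ ℤ.*-assoc c d _ ⟩
  c ℤ.* (d ℤ.* coeff r 0)                    ≡⟨ cong (c ℤ.*_) (coeff-*-zero d p r) ⟨
  c ℤ.* coeff ((d ∷ p) *ₚ r) 0               ∎
  where open ≡-Reasoning
scale-*ₚ c (d ∷ p) r (suc i) = begin
  coeff ((c ℤ.* d ∷ map (c ℤ.*_) p) *ₚ r) (suc i)
    ≡⟨ coeff-*-suc (c ℤ.* d) (map (c ℤ.*_) p) r i ⟩
  c ℤ.* d ℤ.* coeff r (suc i) ℤ.+ coeff (map (c ℤ.*_) p *ₚ r) i
    ≡⟨ cong (λ x → c ℤ.* d ℤ.* coeff r (suc i) ℤ.+ x) (scale-*ₚ c p r i) ⟩
  c ℤ.* d ℤ.* coeff r (suc i) ℤ.+ c ℤ.* coeff (p *ₚ r) i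
    ≡⟨ exch c d (coeff r (suc i)) (coeff (p *ₚ r) i) ⟩
  c ℤ.* (d ℤ.* coeff r (suc i) ℤ.+ coeff (p *ₚ r) i)
    ≡⟨ cong (c ℤ.*_) (coeff-*-suc d p r i) ⟨
  c ℤ.* coeff ((d ∷ p) *ₚ r) (suc i) ∎
  where
  open ≡-Reasoning
  exch : ∀ c d x y → c ℤ.* d ℤ.* x ℤ.+ c ℤ.* y ≡ c ℤ.* (d ℤ.* x ℤ.+ y)
  exch = solve-∀

shift-*ₚ : ∀ p r → (+ 0 ∷ p) *ₚ r ≈ₚ + 0 ∷ (p *ₚ r)
shift-*ₚ p r zero    = coeff-*-zero (+ 0) p r
shift-*ₚ p r (suc i) = trans (coeff-*-suc (+ 0) p r i) (ℤ.+-identityˡ _)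

*ₚ-assoc : ∀ p r s → (p *ₚ r) *ₚ s ≈ₚ p *ₚ (r *ₚ s)
*ₚ-assoc []      r s i = refl
*ₚ-assoc (c ∷ p) r s i = trans (*ₚ-distribʳ s (map (c ℤ.*_) r) (+ 0 ∷ p *ₚ r) i)
  (+ₚ-cong {map (c ℤ.*_) r *ₚ s} {map (c ℤ.*_) (r *ₚ s)} {(+ 0 ∷ p *ₚ r) *ₚ s} {+ 0 ∷ p *ₚ (r *ₚ s)}
           (λ j → trans (scale-*ₚ c r s j) (sym (coeff-scale c (r *ₚ s) j)))
           (λ j → trans (shift-*ₚ (p *ₚ r) s j) (∷-cong j)) i)
  where
  ∷-cong : (+ 0 ∷ (p *ₚ r) *ₚ s) ≈ₚ (+ 0 ∷ p *ₚ (r *ₚ s))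
  ∷-cong zero    = refl
  ∷-cong (suc j) = *ₚ-assoc p r s j

*ₚ-identityˡ : ∀ p → oneₚ *ₚ p ≈ₚ p
*ₚ-identityˡ p zero    = trans (coeff-*-zero (+ 1) [] p) (ℤ.*-identityˡ _)
*ₚ-identityˡ p (suc i) = trans (coeff-*-suc (+ 1) [] p i)
  (trans (ℤ.+-identityʳ _) (ℤ.*-identityˡ _))

polyRing : CommutativeRing 0ℓ 0ℓ
polyRing = record
  { Carrier = Poly ; _≈_ = _≈ₚ_ ; _+_ = _+ₚ_ ; _*_ = _*ₚ_ ; -_ = negₚ ; 0# = [] ; 1# = oneₚ
  ; isCommutativeRing = record
    { isRing = record
      { +-isAbelianGroup = record
        { isGroup = record
          { isMonoid = record
            { isSemigroup = record
              { isMagma = record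
                { isEquivalence = record
                  { refl  = λ _ → refl
                  ; sym   = λ e i → sym (e i)
                  ; trans = λ e f i → trans (e i) (f i) }
                ; ∙-cong = λ {p} {p′} {r} {r′} → +ₚ-cong {p} {p′} {r} {r′} }
              ; assoc = +ₚ-assoc }
            ; identity = (λ _ _ → refl) , +ₚ-identityʳ }
          ; inverse = (λ p i → trans (+ₚ-comm (negₚ p) p i) (+ₚ-inverseʳ p i)) , +ₚ-inverseʳ
          ; ⁻¹-cong = λ {p} {r} e i → trans (coeff-neg p i)
              (trans (cong ℤ.-_ (e i)) (sym (coeff-neg r i))) }
        ; comm = +ₚ-comm }
      ; *-cong = λ {p} {p′} {r} {r′} → *ₚ-cong {p} {p′} {r} {r′}
      ; *-assoc = *ₚ-assoc
      ; *-identity = *ₚ-identityˡ , λ p i → trans (*ₚ-comm p oneₚ i) (*ₚ-identityˡ p i)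
      ; distrib = *ₚ-distribˡ , *ₚ-distribʳ }
    ; *-comm = *ₚ-comm } }
  where
  +ₚ-comm : ∀ p r → p +ₚ r ≈ₚ r +ₚ p
  +ₚ-comm p r i = trans (coeff-+ p r i) (trans (ℤ.+-comm (coeff p i) _) (sym (coeff-+ r p i)))
  +ₚ-identityʳ : ∀ p → p +ₚ [] ≈ₚ p
  +ₚ-identityʳ p i = trans (coeff-+ p [] i) (ℤ.+-identityʳ _)
  +ₚ-inverseʳ : ∀ p → p +ₚ negₚ p ≈ₚ []
  +ₚ-inverseʳ p i = trans (coeff-+ p (negₚ p) i)
    (trans (cong (λ x → coeff p i ℤ.+ x) (coeff-neg p i)) (ℤ.+-inverseʳ (coeff p i)))
  +ₚ-assoc : ∀ p r s → (p +ₚ r) +ₚ s ≈ₚ p +ₚ (r +ₚ s)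
  +ₚ-assoc p r s i = trans (coeff-+ (p +ₚ r) s i)
    (trans (cong (ℤ._+ coeff s i) (coeff-+ p r i))
    (trans (ℤ.+-assoc (coeff p i) (coeff r i) (coeff s i))
    (sym (trans (coeff-+ p (r +ₚ s) i) (cong (λ x → coeff p i ℤ.+ x) (coeff-+ r s i))))))

-- Exchange operators on words

module Unimodality where

  open import Data.Integer using (_+_; _-_; -_; _*_)

  Word : Set
  Word = List Bool

  WordFun : Set
  WordFun = Word → ℤ

  Weight : Set
  Weight = ℕ → ℕ → ℤ

  bond : Bool → Bool → Bool → ℤ
  bond true  true  false = + 1
  bond true  true  true  = + 0
  bond true  false _     = + 0
  bond false false true  = + 1
  bond false false false = + 0
  bond false true  _     = + 0

  -- hop x f p v S sums v over the words obtained from S by exchanging an adjacent pair x (not x).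
  -- Exchanging the letters after the first i of S, with n letters to their right, has weight f (p + i) n.
  hop₀ : Bool → Weight → ℕ → Bool → WordFun → WordFun
  hop₀ x f p b v []      = + 0
  hop₀ x f p b v (c ∷ S) = bond x b c * (f p (length S) * v (c ∷ b ∷ S))

  hop : Bool → Weight → ℕ → WordFun → WordFun
  hop x f p v []      = + 0
  hop x f p v (b ∷ S) = hop₀ x f p b v S + hop x f (suc p) (v ∘ (b ∷_)) S

  a0+b0≡0 : ∀ a b → + 0 ≡ a * + 0 + b * + 0
  a0+b0≡0 = solve-∀

  -- An exchange preserves the length, so coefficients depending on the length alone behave like
  -- scalars. `hop-hop₀` needs this generality: the weight pulled out of a hop there depends on the
  -- number of letters to the right.
  hop-linear : ∀ x f p (h h′ : ℕ → ℤ) {v u w : WordFun} →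
    (∀ S → w S ≡ h (length S) * v S + h′ (length S) * u S) →
    ∀ S → hop x f p w S ≡ h (length S) * hop x f p v S + h′ (length S) * hop x f p u S
  hop-linear x f p h h′ e [] = a0+b0≡0 (h 0) (h′ 0)
  hop-linear x f p h h′ {v} {u} {w} e (b ∷ S) =
    trans (cong₂ _+_ (head S) (hop-linear x f (suc p) (h ∘ suc) (h′ ∘ suc) (e ∘ (b ∷_)) S))
          (regroup (h (suc (length S))) (h′ (suc (length S))) _ _ _ _)
    where
    regroup : ∀ a a′ m m′ n n′ →
      (a * m + a′ * m′) + (a * n + a′ * n′) ≡ a * (m + n) + a′ * (m′ + n′)
    regroup = solve-∀
    expand : ∀ a a′ k f m m′ →
      k * (f * (a * m + a′ * m′)) ≡ a * (k * (f * m)) + a′ * (k * (f * m′))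
    expand = solve-∀
    head : ∀ S → hop₀ x f p b w S ≡
      h (suc (length S)) * hop₀ x f p b v S + h′ (suc (length S)) * hop₀ x f p b u S
    head []      = a0+b0≡0 (h 1) (h′ 1)
    head (c ∷ S) = trans (cong (λ y → bond x b c * (f p (length S) * y)) (e (c ∷ b ∷ S)))
      (expand (h (suc (suc (length S)))) (h′ (suc (suc (length S)))) (bond x b c) (f p (length S))
              (v (c ∷ b ∷ S)) (u (c ∷ b ∷ S)))

  hop-scale : ∀ x f p (h : ℕ → ℤ) {v w : WordFun} → (∀ S → w S ≡ h (length S) * v S) →
    ∀ S → hop x f p w S ≡ h (length S) * hop x f p v S
  hop-scale x f p h {v} e S =
    trans (hop-linear x f p h (λ _ → + 0) {v} {v} (λ S → trans (e S) (sym (ℤ.+-identityʳ _))) S)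
          (ℤ.+-identityʳ _)

  hop-+ : ∀ x f p {v u w : WordFun} → (∀ S → w S ≡ v S + u S) →
    ∀ S → hop x f p w S ≡ hop x f p v S + hop x f p u S
  hop-+ x f p {v} {u} e S =
    trans (hop-linear x f p (λ _ → + 1) (λ _ → + 1) {v} {u}
            (λ S → trans (e S) (units (v S) (u S))) S)
          (sym (units (hop x f p v S) (hop x f p u S)))
    where
    units : ∀ a b → a + b ≡ + 1 * a + + 1 * b
    units = solve-∀

  -- Exchanging c and d brings `not x` next to b, where an exchange of the opposite kind would
  -- require `x`. The variable y with its equation replaces `not x` because both orientations are
  -- used and `not (not x)` does not reduce.
  bond-blocksˡ : ∀ x {y} → y ≡ not x → ∀ b c d → bond x c d * bond y b d ≡ + 0
  bond-blocksˡ true  refl true  true  true  = refl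
  bond-blocksˡ true  refl true  true  false = refl
  bond-blocksˡ true  refl false true  true  = refl
  bond-blocksˡ true  refl false true  false = refl
  bond-blocksˡ true  refl b     false d     = refl
  bond-blocksˡ false refl true  false true  = refl
  bond-blocksˡ false refl true  false false = refl
  bond-blocksˡ false refl false false true  = refl
  bond-blocksˡ false refl false false false = refl
  bond-blocksˡ false refl b     true  d     = refl

  bond-blocksʳ : ∀ x {y} → y ≡ not x → ∀ b c d → bond y b c * bond x b d ≡ + 0
  bond-blocksʳ true  refl true  c     d = refl
  bond-blocksʳ true  refl false c     d = ℤ.*-zeroʳ (bond false false c)
  bond-blocksʳ false refl false c     d = refl
  bond-blocksʳ false refl true  c     d = ℤ.*-zeroʳ (bond true true c)

  bond-reverse : ∀ x {y} → y ≡ not x → ∀ b c → bond y b c * bond x c b ≡ bond y b c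
  bond-reverse true  refl true  c     = refl
  bond-reverse true  refl false true  = refl
  bond-reverse true  refl false false = refl
  bond-reverse false refl false c     = refl
  bond-reverse false refl true  true  = refl
  bond-reverse false refl true  false = refl

  -- The weight of exchanging the first two letters and then exchanging them back, the only double
  -- exchange at the head that returns to the starting word.
  local : Bool → Weight → Weight → ℕ → Bool → Word → ℤ
  local y f g p b []      = + 0
  local y f g p b (c ∷ T) = bond y b c * (f p (length T) * g p (length T))

  -- Exchanges at overlapping but distinct places exclude each other, so only the exchange
  -- at the same place fails to commute.
  hop-hop₀ : ∀ x {y} → y ≡ not x → ∀ f g p b v S →
    hop x f (suc p) (hop₀ y g p b v) S + local y f g p b S * v (b ∷ S) ≡
    hop₀ y g p b (hop x f p v) S
  hop-hop₀ x y≡ f g p b v [] = refl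
  hop-hop₀ x {y} y≡ f g p b v (c ∷ T) = begin
    (hop₀ x f (suc p) c (hop₀ y g p b v) T
      + hop x f (suc (suc p)) (λ T → hop₀ y g p b v (c ∷ T)) T)
      + β * (f p (length T) * g p (length T)) * v (b ∷ c ∷ T)
        ≡⟨ cong (_+ β * (f p (length T) * g p (length T)) * v (b ∷ c ∷ T))
             (cong₂ _+_ (blockedˡ T)
               (hop-scale x f (suc (suc p)) (λ n → β * g p n)
                 (λ T → sym (ℤ.*-assoc β (g p (length T)) (v (c ∷ b ∷ T)))) T)) ⟩
    (+ 0 + β * g p (length T) * rest) + β * (f p (length T) * g p (length T)) * v (b ∷ c ∷ T)
        ≡⟨ regroup₁ β (f p (length T)) (g p (length T)) rest (v (b ∷ c ∷ T)) ⟩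
    β * (f p (length T) * g p (length T) * v (b ∷ c ∷ T)) + β * (g p (length T) * rest) + g p (length T) * + 0
        ≡⟨ cong₂ (λ s t → s * (f p (length T) * g p (length T) * v (b ∷ c ∷ T))
              + β * (g p (length T) * rest) + g p (length T) * t)
             (bond-reverse x y≡ b c) (blockedʳ T) ⟨
    β * bond x c b * (f p (length T) * g p (length T) * v (b ∷ c ∷ T)) + β * (g p (length T) * rest)
      + g p (length T) * (β * hop₀ x f (suc p) b (v ∘ (c ∷_)) T)
        ≡⟨ regroup₂ β (bond x c b) (f p (length T)) (g p (length T)) (v (b ∷ c ∷ T)) rest _ ⟩
    β * (g p (length T) * (bond x c b * (f p (length T) * v (b ∷ c ∷ T))
      + (hop₀ x f (suc p) b (v ∘ (c ∷_)) T + rest))) ∎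
    where
    open ≡-Reasoning
    β = bond y b c
    rest = hop x f (suc (suc p)) (λ T → v (c ∷ b ∷ T)) T
    swap₄ : ∀ k f l w → k * (f * (l * w)) ≡ k * l * (f * w)
    swap₄ = solve-∀
    blockedˡ : ∀ T → hop₀ x f (suc p) c (hop₀ y g p b v) T ≡ + 0
    blockedˡ []      = refl
    blockedˡ (d ∷ T) = trans (swap₄ (bond x c d) (f (suc p) (length T)) (bond y b d) w)
      (cong (_* (f (suc p) (length T) * w)) (bond-blocksˡ x y≡ b c d))
      where w = g p (length (c ∷ T)) * v (d ∷ b ∷ c ∷ T)
    blockedʳ : ∀ T → β * hop₀ x f (suc p) b (v ∘ (c ∷_)) T ≡ + 0
    blockedʳ []      = ℤ.*-zeroʳ β
    blockedʳ (d ∷ T) = trans (sym (ℤ.*-assoc β (bond x b d) _))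
      (cong (_* (f (suc p) (length T) * v (c ∷ d ∷ b ∷ T))) (bond-blocksʳ x y≡ b c d))
    regroup₁ : ∀ β f g r w → (+ 0 + β * g * r) + β * (f * g) * w ≡ β * (f * g * w) + β * (g * r) + g * + 0
    regroup₁ = solve-∀
    regroup₂ : ∀ β k f g w r m → β * k * (f * g * w) + β * (g * r) + g * (β * m)
      ≡ β * (g * (k * (f * w) + (m + r)))
    regroup₂ = solve-∀

  -- The diagonal that remains of the commutator. A pair `x`, `not x` can be exchanged and restored
  -- only with `hop x` outermost, a pair `not x`, `x` only in the other order; hence the opposite
  -- signs.
  defect : Bool → Weight → Weight → ℕ → Word → ℤ
  defect x f g p []      = + 0
  defect x f g p (b ∷ S) = (local x f g p b S - local (not x) f g p b S) + defect x f g (suc p) S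

  local-comm : ∀ y f g p b S → local y f g p b S ≡ local y g f p b S
  local-comm y f g p b []      = refl
  local-comm y f g p b (c ∷ T) = cong (bond y b c *_) (ℤ.*-comm (f p (length T)) _)

  -- Induction on the word, splitting each hop into head and tail. The product of the two tails is
  -- the induction hypothesis; `hop-hop₀`, applied in both orientations, carries a head exchange
  -- past the other hop at the price of one `local` term each time.
  hop-commutator : ∀ x f g p v S →
    hop x f p (hop (not x) g p v) S ≡ hop (not x) g p (hop x f p v) S + defect x f g p S * v S
  hop-commutator x f g p v []      = refl
  hop-commutator x f g p v (b ∷ S) = begin
    hop₀ x f p b (hop y g p v) S + hop x f (suc p) (λ S → hop₀ y g p b v S + hop y g (suc p) (v ∘ (b ∷_)) S) S
      ≡⟨ cong₂ _+_ (hop-hop₀ y x≡ g f p b v S)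
           (sym (hop-+ x f (suc p) {hop₀ y g p b v} {hop y g (suc p) (v ∘ (b ∷_))} (λ _ → refl) S)) ⟨
    (Y + local x g f p b S * w) + (X + hop x f (suc p) (hop y g (suc p) (v ∘ (b ∷_))) S)
      ≡⟨ cong₂ (λ s t → (Y + s * w) + (X + t)) (local-comm x g f p b S) (hop-commutator x f g (suc p) (v ∘ (b ∷_)) S) ⟩
    (Y + local x f g p b S * w) + (X + (Z + defect x f g (suc p) S * w))
      ≡⟨ regroup X Y Z w (local x f g p b S) (local y f g p b S) _ ⟩
    ((X + local y f g p b S * w) + (Y + Z)) + ((local x f g p b S - local y f g p b S) + defect x f g (suc p) S) * w
      ≡⟨ cong (_+ ((local x f g p b S - local y f g p b S) + defect x f g (suc p) S) * w)
           (cong₂ _+_ (hop-hop₀ x refl f g p b v S)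
             (sym (hop-+ y g (suc p) {hop₀ x f p b v} {hop x f (suc p) (v ∘ (b ∷_))} (λ _ → refl) S))) ⟩
    (hop₀ y g p b (hop x f p v) S + hop y g (suc p) (λ S → hop₀ x f p b v S + hop x f (suc p) (v ∘ (b ∷_)) S) S)
      + ((local x f g p b S - local y f g p b S) + defect x f g (suc p) S) * w ∎
    where
    open ≡-Reasoning
    y = not x
    w = v (b ∷ S)
    X = hop x f (suc p) (hop₀ y g p b v) S
    Y = hop y g (suc p) (hop₀ x f p b v) S
    Z = hop y g (suc p) (hop x f (suc p) (v ∘ (b ∷_))) S
    x≡ : x ≡ not y
    x≡ = sym (Bool.not-involutive x)
    regroup : ∀ X Y Z w l m d → (Y + l * w) + (X + (Z + d * w)) ≡ ((X + m * w) + (Y + Z)) + ((l - m) + d) * w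
    regroup = solve-∀

  -- Inversion statistic and the eigenvalue of the commutator

  zeros ones rank : Word → ℕ
  zeros []          = 0
  zeros (false ∷ S) = suc (zeros S)
  zeros (true ∷ S)  = zeros S
  ones []          = 0
  ones (false ∷ S) = ones S
  ones (true ∷ S)  = suc (ones S)
  rank []          = 0
  rank (false ∷ S) = rank S
  rank (true ∷ S)  = zeros S ℕ.+ rank S

  length-zeros-ones : ∀ S → length S ≡ zeros S ℕ.+ ones S
  length-zeros-ones []          = refl
  length-zeros-ones (false ∷ S) = cong suc (length-zeros-ones S)
  length-zeros-ones (true ∷ S)  = trans (cong suc (length-zeros-ones S)) (sym (ℕ.+-suc (zeros S) (ones S)))

  -- The matrix entries (i + 1)(N - 1 - i) of the lowering operator on the N-dimensional
  -- irreducible representation of sl₂.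
  unit descent : Weight
  unit    p n = + 1
  descent p n = + suc p * + suc n

  lead : Word → ℤ
  lead (true ∷ S) = + length (true ∷ S)
  lead _          = + 0

  -- Abel summation; the boundary term at the left end disappears for p = 0.
  defect-closed : ∀ p S → defect true unit descent p S ≡
    + p * lead S + (+ 2 * + rank S - + zeros S * + ones S) - + p * + ones S
  defect-closed p []           = go (+ p)
    where
    go : ∀ p → + 0 ≡ p * + 0 + (+ 2 * + 0 - + 0 * + 0) - p * + 0
    go = solve-∀
  defect-closed p (false ∷ []) = go (+ p)
    where
    go : ∀ p → + 0 ≡ p * + 0 + (+ 2 * + 0 - + 1 * + 0) - p * + 0
    go = solve-∀
  defect-closed p (true ∷ [])  = go (+ p)
    where
    go : ∀ p → + 0 ≡ p * + 1 + (+ 2 * + 0 - + 0 * + 1) - p * + 1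
    go = solve-∀
  defect-closed p (false ∷ false ∷ T) rewrite defect-closed (suc p) (false ∷ T) =
    go (+ p) (+ zeros T) (+ ones T) (+ rank T)
    where
    go : ∀ p z k r → + 0 + ((+ 1 + p) * + 0 + (+ 2 * r - (+ 1 + z) * k) - (+ 1 + p) * k)
      ≡ p * + 0 + (+ 2 * r - (+ 2 + z) * k) - p * k
    go = solve-∀
  defect-closed p (false ∷ true ∷ T) rewrite defect-closed (suc p) (true ∷ T) | length-zeros-ones T =
    go (+ p) (+ zeros T) (+ ones T) (+ rank T)
    where
    go : ∀ p z k r → + 0 - + 1 * (+ 1 * ((+ 1 + p) * (+ 1 + (z + k)))) +
      ((+ 1 + p) * (+ 1 + (z + k)) + (+ 2 * (z + r) - z * (+ 1 + k)) - (+ 1 + p) * (+ 1 + k))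
      ≡ p * + 0 + (+ 2 * (z + r) - (+ 1 + z) * (+ 1 + k)) - p * (+ 1 + k)
    go = solve-∀
  defect-closed p (true ∷ false ∷ T) rewrite defect-closed (suc p) (false ∷ T) | length-zeros-ones T =
    go (+ p) (+ zeros T) (+ ones T) (+ rank T)
    where
    go : ∀ p z k r → + 1 * (+ 1 * ((+ 1 + p) * (+ 1 + (z + k)))) - + 0 +
      ((+ 1 + p) * + 0 + (+ 2 * r - (+ 1 + z) * k) - (+ 1 + p) * k)
      ≡ p * (+ 2 + (z + k)) + (+ 2 * (+ 1 + z + r) - (+ 1 + z) * (+ 1 + k)) - p * (+ 1 + k)
    go = solve-∀
  defect-closed p (true ∷ true ∷ T) rewrite defect-closed (suc p) (true ∷ T) | length-zeros-ones T =
    go (+ p) (+ zeros T) (+ ones T) (+ rank T)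
    where
    go : ∀ p z k r → + 0 +
      ((+ 1 + p) * (+ 1 + (z + k)) + (+ 2 * (z + r) - z * (+ 1 + k)) - (+ 1 + p) * (+ 1 + k))
      ≡ p * (+ 2 + (z + k)) + (+ 2 * (z + (z + r)) - z * (+ 2 + k)) - p * (+ 2 + k)
    go = solve-∀

  -- Linear relations

  module _ {X : Set} where

    comb : ∀ {m} → Vec ℤ m → Vec (X → ℤ) m → X → ℤ
    comb []       []       x = + 0
    comb (c ∷ cs) (b ∷ bs) x = c * b x + comb cs bs x

    comb-0 : ∀ {m} (bs : Vec (X → ℤ) m) x → comb (Vec.replicate m (+ 0)) bs x ≡ + 0
    comb-0 []       x = refl
    comb-0 (b ∷ bs) x = trans (ℤ.+-identityˡ _) (comb-0 bs x)

    comb-scale : ∀ {m} p (cs : Vec ℤ m) (bs : Vec (X → ℤ) m) x →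
      comb (Vec.map (p *_) cs) bs x ≡ p * comb cs bs x
    comb-scale p []       []       x = sym (ℤ.*-zeroʳ p)
    comb-scale p (c ∷ cs) (b ∷ bs) x =
      trans (cong (λ y → p * c * b x + y) (comb-scale p cs bs x)) (regroup p c (b x) _)
      where
      regroup : ∀ p c b y → p * c * b + p * y ≡ p * (c * b + y)
      regroup = solve-∀

    eliminate : (X → ℤ) → X → (X → ℤ) → X → ℤ
    eliminate b x₀ d x = b x₀ * d x - d x₀ * b x

    comb-eliminate : ∀ {m} b x₀ (cs : Vec ℤ m) (bs : Vec (X → ℤ) m) x →
      comb cs (Vec.map (eliminate b x₀) bs) x ≡ b x₀ * comb cs bs x - comb cs bs x₀ * b x
    comb-eliminate b x₀ []       []       x = vanishing (b x₀) (b x)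
      where
      vanishing : ∀ a b → + 0 ≡ a * + 0 - + 0 * b
      vanishing = solve-∀
    comb-eliminate b x₀ (c ∷ cs) (d ∷ bs) x =
      trans (cong (λ y → c * (b x₀ * d x - d x₀ * b x) + y) (comb-eliminate b x₀ cs bs x))
            (regroup (b x₀) (b x) c (d x₀) (d x) (comb cs bs x) (comb cs bs x₀))
      where
      regroup : ∀ p b c e d y z → c * (p * d - e * b) + (p * y - z * b) ≡ p * (c * d + y) - (c * e + z) * b
      regroup = solve-∀

    -- Fraction-free Gaussian elimination. If the first function vanishes on `xs`, it is a relation
    -- by itself. Otherwise it is the pivot at some `x₀`; cross-multiplication clears `x₀` from the
    -- other functions, and both the pivot and the point drop out of the recursion.
    nontrivial-relation : ∀ {m} (bs : Vec (X → ℤ) m) (xs : List X) → length xs ℕ.< m →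
      Σ (Vec ℤ m) λ cs → (∃ λ i → Vec.lookup cs i ≢ + 0) × All (λ x → comb cs bs x ≡ + 0) xs
    nontrivial-relation {suc m} (b ∷ bs) xs lt with any? (λ x → ¬? (b x ℤ.≟ + 0)) xs
    ... | no b≡0 = + 1 ∷ Vec.replicate m (+ 0) , (zero , λ ()) ,
      All.map (λ {x} bx≢0 → trans (cong₂ _+_ (trans (ℤ.*-identityˡ (b x))
                  (decidable-stable (b x ℤ.≟ + 0) bx≢0)) (comb-0 bs x)) refl)
              (All.¬Any⇒All¬ xs b≡0)
    ... | yes b≢0 with find b≢0
    ...   | x₀ , x₀∈ , bx₀≢0 with ∈-∃++ x₀∈
    ...     | ys , zs , refl
      with nontrivial-relation (Vec.map (eliminate b x₀) bs) (ys ++ zs)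
             (ℕ.s≤s⁻¹ (subst (ℕ._≤ suc m) (cong suc (trans (List.length-++ ys)
                (trans (ℕ.+-suc (length ys) (length zs)) (cong suc (sym (List.length-++ ys)))))) lt))
    ...       | cs , (i , csᵢ≢0) , rel = cs′ , (suc i , cs′ᵢ≢0) ,
      All.++⁺ (All.map vanish (All.++⁻ˡ ys rel)) (pivot ∷ All.map vanish (All.++⁻ʳ ys rel))
      where
      -- With these coefficients the combination of the original functions is the relation found
      -- among the eliminated ones, and at `x₀` it cancels. The factor `b x₀` is nonzero and ℤ has
      -- no zero divisors, so the relation stays nontrivial.
      cs′ = - comb cs bs x₀ ∷ Vec.map (b x₀ *_) cs
      cs′ᵢ≢0 : Vec.lookup (Vec.map (b x₀ *_) cs) i ≢ + 0
      cs′ᵢ≢0 e with ℤ.i*j≡0⇒i≡0∨j≡0 (b x₀) (trans (sym (Vec.lookup-map i (b x₀ *_) cs)) e)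
      ... | inj₁ e′ = bx₀≢0 e′
      ... | inj₂ e′ = csᵢ≢0 e′
      neg-exch : ∀ z b p y → - z * b + p * y ≡ p * y - z * b
      neg-exch = solve-∀
      value : ∀ x → comb cs′ (b ∷ bs) x ≡ b x₀ * comb cs bs x - comb cs bs x₀ * b x
      value x = trans (cong (λ y → - comb cs bs x₀ * b x + y) (comb-scale (b x₀) cs bs x))
        (neg-exch (comb cs bs x₀) (b x) (b x₀) _)
      vanish : ∀ {x} → comb cs (Vec.map (eliminate b x₀) bs) x ≡ + 0 → comb cs′ (b ∷ bs) x ≡ + 0
      vanish {x} e = trans (value x) (trans (sym (comb-eliminate b x₀ cs bs x)) e)
      cancel : ∀ p y → p * y - y * p ≡ + 0
      cancel = solve-∀
      pivot : comb cs′ (b ∷ bs) x₀ ≡ + 0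
      pivot = trans (value x₀) (cancel (b x₀) (comb cs bs x₀))

  -- Delta functions and dimension counting

  _≟ʷ_ : (S T : Word) → Dec (S ≡ T)
  _≟ʷ_ = List.≡-dec Bool._≟_

  δ : Word → WordFun
  δ S T with S ≟ʷ T
  ... | yes _ = + 1
  ... | no  _ = + 0

  δ-refl : ∀ S → δ S S ≡ + 1
  δ-refl S with S ≟ʷ S
  ... | yes _   = refl
  ... | no  S≢S = contradiction refl S≢S

  δ-≢ : ∀ {S T} → S ≢ T → δ S T ≡ + 0
  δ-≢ {S} {T} S≢T with S ≟ʷ T
  ... | yes S≡T = contradiction S≡T S≢T
  ... | no  _   = refl

  deltas : (L : List Word) → Vec WordFun (length L)
  deltas L = Vec.map δ (Vec.fromList L)

  comb-δ-∉ : ∀ L (cs : Vec ℤ (length L)) {S} → S ∉ L → comb cs (deltas L) S ≡ + 0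
  comb-δ-∉ []      []       S∉ = refl
  comb-δ-∉ (T ∷ L) (c ∷ cs) S∉ =
    cong₂ _+_ (trans (cong (c *_) (δ-≢ (λ T≡S → S∉ (here (sym T≡S))))) (ℤ.*-zeroʳ c))
              (comb-δ-∉ L cs (S∉ ∘ there))

  comb-δ-lookup : ∀ L (cs : Vec ℤ (length L)) → Unique L → ∀ i →
    comb cs (deltas L) (List.lookup L i) ≡ Vec.lookup cs i
  comb-δ-lookup (T ∷ L) (c ∷ cs) (T∉ ∷ uniq) zero =
    trans (cong₂ _+_ (trans (cong (c *_) (δ-refl T)) (ℤ.*-identityʳ c))
                     (comb-δ-∉ L cs (λ T∈ → All.lookup T∉ T∈ refl)))
          (ℤ.+-identityʳ c)
  comb-δ-lookup (T ∷ L) (c ∷ cs) (T∉ ∷ uniq) (suc i) =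
    trans (cong₂ _+_ (trans (cong (c *_) (δ-≢ (All.lookup T∉ (∈-lookup i)))) (ℤ.*-zeroʳ c))
                     (comb-δ-lookup L cs uniq i))
          (ℤ.+-identityˡ _)

  hop-comb : ∀ x f p {m} (cs : Vec ℤ m) (bs : Vec WordFun m) S →
    hop x f p (comb cs bs) S ≡ comb cs (Vec.map (hop x f p) bs) S
  hop-comb x f p []       []       S = hop-scale x f p (λ _ → + 0) {λ _ → + 0} (λ _ → refl) S
  hop-comb x f p (c ∷ cs) (b ∷ bs) S =
    trans (hop-linear x f p (λ _ → c) (λ _ → + 1) {b} {comb cs bs}
            (λ T → cong (λ y → c * b T + y) (sym (ℤ.*-identityˡ _))) S)
          (cong (λ y → c * hop x f p b S + y)
            (trans (ℤ.*-identityˡ _) (hop-comb x f p cs bs S)))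

  -- Were `L` longer, the images of its delta functions would satisfy a nontrivial relation on `L′`.
  -- The same coefficients combine the delta functions into a function supported on `L` whose image
  -- vanishes on `L′`; as `L` has no repetitions, its values are these coefficients, so it is not
  -- zero.
  hop-injective⇒≤ : ∀ x f p (L L′ : List Word) → Unique L →
    (∀ v → (∀ S → v S ≢ + 0 → S ∈ L) → (∀ T → T ∈ L′ → hop x f p v T ≡ + 0) → ∀ S → v S ≡ + 0) →
    length L ℕ.≤ length L′
  hop-injective⇒≤ x f p L L′ uniq injective with length L ℕ.≤? length L′
  ... | yes L≤L′ = L≤L′
  ... | no  L≰L′ with nontrivial-relation (Vec.map (hop x f p) (deltas L)) L′ (ℕ.≰⇒> L≰L′)
  ...   | cs , (i , csᵢ≢0) , rel = contradiction
    (trans (sym (comb-δ-lookup L cs uniq i))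
           (injective (comb cs (deltas L)) support
             (λ T T∈ → trans (hop-comb x f p cs (deltas L) T) (All.lookup rel T∈))
             (List.lookup L i)))
    csᵢ≢0
    where
    open import Data.List.Membership.DecPropositional _≟ʷ_ using (_∈?_)
    support : ∀ S → comb cs (deltas L) S ≢ + 0 → S ∈ L
    support S ≢0 = decidable-stable (S ∈? L) (λ S∉ → ≢0 (comb-δ-∉ L cs S∉))

  -- Injectivity of the raising and lowering operators

  -- Oriented as `hop` reads: a value of `hop x` at the first word is built from values at the
  -- second.
  data Swap : Bool → Word → Word → Set where
    here  : ∀ {x S} → Swap x (x ∷ not x ∷ S) (not x ∷ x ∷ S)
    there : ∀ {x b S T} → Swap x S T → Swap x (b ∷ S) (b ∷ T)

  swap-zeros : ∀ {x S T} → Swap x S T → zeros T ≡ zeros S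
  swap-zeros (here {true})        = refl
  swap-zeros (here {false})       = refl
  swap-zeros (there {b = true} s)  = swap-zeros s
  swap-zeros (there {b = false} s) = cong suc (swap-zeros s)

  swap-ones : ∀ {x S T} → Swap x S T → ones T ≡ ones S
  swap-ones (here {true})        = refl
  swap-ones (here {false})       = refl
  swap-ones (there {b = true} s)  = cong suc (swap-ones s)
  swap-ones (there {b = false} s) = swap-ones s

  swap-true-rank : ∀ {S T} → Swap true S T → rank S ≡ suc (rank T)
  swap-true-rank here = refl
  swap-true-rank (there {b = false} s) = swap-true-rank s
  swap-true-rank (there {b = true} {S} {T} s) rewrite swap-zeros s | swap-true-rank s =
    ℕ.+-suc (zeros S) (rank T)

  swap-false-rank : ∀ {S T} → Swap false S T → rank T ≡ suc (rank S)
  swap-false-rank here = refl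
  swap-false-rank (there {b = false} s) = swap-false-rank s
  swap-false-rank (there {b = true} {S} {T} s) rewrite swap-zeros s | swap-false-rank s =
    ℕ.+-suc (zeros S) (rank S)

  *-≢0ʳ : ∀ a {b} → a * b ≢ + 0 → b ≢ + 0
  *-≢0ʳ a ab≢0 refl = ab≢0 (ℤ.*-zeroʳ a)

  hop₀-support : ∀ x f p b v S → hop₀ x f p b v S ≢ + 0 →
    ∃ λ T → Swap x (b ∷ S) T × v T ≢ + 0
  hop₀-support x     f p b     v []          ≢0 = contradiction refl ≢0
  hop₀-support true  f p true  v (false ∷ S) ≢0 = _ , here , *-≢0ʳ (f p (length S)) (*-≢0ʳ (+ 1) ≢0)
  hop₀-support true  f p true  v (true ∷ S)  ≢0 = contradiction refl ≢0
  hop₀-support true  f p false v (c ∷ S)     ≢0 = contradiction refl ≢0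
  hop₀-support false f p false v (true ∷ S)  ≢0 = _ , here , *-≢0ʳ (f p (length S)) (*-≢0ʳ (+ 1) ≢0)
  hop₀-support false f p false v (false ∷ S) ≢0 = contradiction refl ≢0
  hop₀-support false f p true  v (c ∷ S)     ≢0 = contradiction refl ≢0

  hop-support : ∀ x f p v S → hop x f p v S ≢ + 0 → ∃ λ T → Swap x S T × v T ≢ + 0
  hop-support x f p v []      ≢0 = contradiction refl ≢0
  hop-support x f p v (b ∷ S) ≢0 with hop₀ x f p b v S ℤ.≟ + 0
  ... | no  head≢0 = hop₀-support x f p b v S head≢0
  ... | yes head≡0 with hop-support x f (suc p) (v ∘ (b ∷_)) S
                         (λ tail≡0 → ≢0 (cong₂ _+_ head≡0 tail≡0))
  ...   | T , s , vT≢0 = b ∷ T , there s , vT≢0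

  hop-0 : ∀ x f p v → (∀ S → v S ≡ + 0) → ∀ S → hop x f p v S ≡ + 0
  hop-0 x f p v v≡0 = hop-scale x f p (λ _ → + 0) {v} v≡0

  -- Common frame for raising and lowering. A is the operator to be shown injective, B moves away
  -- from the middle rank, and `Supp e` describes a weight space at distance e from the middle, on
  -- which [A, B] acts as -e.
  module _
    (x y : Bool) (f g : Weight)
    (Supp : ℕ → WordFun → Set) (M : ℕ)
    (bounded : ∀ e v → Supp e v → M ℕ.< e → ∀ S → v S ≡ + 0)
    (step : ∀ e v → Supp e v → Supp (2 ℕ.+ e) (hop y g 0 v))
    (commutator : ∀ e v → Supp e v → ∀ S →
      hop x f 0 (hop y g 0 v) S ≡ hop y g 0 (hop x f 0 v) S - + e * v S)
    where

    private
      A B : WordFun → WordFun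
      A = hop x f 0
      B = hop y g 0

    -- If BAv = -s v, then ABv = -(s + e) v, so Bv is again an eigenvector of BA, of larger
    -- weight; the weights being bounded, Bv = 0 by descent, hence (s + e) v = 0.
    eigenvector-vanishes : ∀ fuel e s v → M ℕ.< fuel ℕ.+ suc e → Supp (suc e) v →
      (∀ S → B (A v) S ≡ - + s * v S) → ∀ S → v S ≡ + 0
    eigenvector-vanishes zero       e s v M<e supp _   = bounded (suc e) v supp M<e
    eigenvector-vanishes (suc fuel) e s v M<e supp eig = λ S →
      positive-cancel (v S) (trans (sym (ABv S)) (hop-0 x f 0 (B v) Bv≡0 S))
      where
      regroup : ∀ s e v → - s * v - e * v ≡ - (s + e) * v
      regroup = solve-∀
      ABv : ∀ S → A (B v) S ≡ - + (s ℕ.+ suc e) * v S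
      ABv S = trans (commutator (suc e) v supp S)
        (trans (cong (_- + suc e * v S) (eig S)) (regroup (+ s) (+ suc e) (v S)))
      Bv≡0 : ∀ S → B v S ≡ + 0
      Bv≡0 = eigenvector-vanishes fuel (2 ℕ.+ e) (s ℕ.+ suc e) (B v)
        (ℕ.<-≤-trans M<e (ℕ.≤-trans (ℕ.≤-reflexive (sym (ℕ.+-suc fuel (suc e))))
          (ℕ.+-monoʳ-≤ fuel (ℕ.n≤1+n _)))) (step (suc e) v supp)
        (hop-scale y g 0 (λ _ → - + (s ℕ.+ suc e)) ABv)
      positive-cancel : ∀ w → - + (s ℕ.+ suc e) * w ≡ + 0 → w ≡ + 0
      positive-cancel w eq with ℤ.i*j≡0⇒i≡0∨j≡0 (- + (s ℕ.+ suc e)) eq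
      ... | inj₂ w≡0 = w≡0
      ... | inj₁ eq′ with subst (λ n → - + n ≡ + 0) (ℕ.+-suc s e) eq′
      ...   | ()

    -- The case s = 0, since Av = 0 gives BAv = 0. The weight is written `suc e` because s + e must
    -- be nonzero to be cancelled.
    hop-injective : ∀ e v → Supp (suc e) v → (∀ S → A v S ≡ + 0) → ∀ S → v S ≡ + 0
    hop-injective e v supp Av≡0 = eigenvector-vanishes (suc M) e 0 v
      (ℕ.m≤m+n (suc M) (suc e)) supp (hop-0 y g 0 (A v) Av≡0)

  rank≤zeros*ones : ∀ S → rank S ℕ.≤ zeros S ℕ.* ones S
  rank≤zeros*ones []          = ℕ.z≤n
  rank≤zeros*ones (false ∷ S) = ℕ.≤-trans (rank≤zeros*ones S) (ℕ.m≤n+m _ (ones S))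
  rank≤zeros*ones (true ∷ S)  = ℕ.≤-trans (ℕ.+-monoʳ-≤ (zeros S) (rank≤zeros*ones S))
    (ℕ.≤-reflexive (sym (ℕ.*-suc (zeros S) (ones S))))

  -- A one at place i of N contributes (N-1-i) - i, the letters to its right minus those to its
  -- left. Ones against ones cancel in the sum; the zeros to the right of ones add up to the rank,
  -- and those to the left to the remaining zeros * ones - rank pairs.
  defect₀ : ∀ S → defect true unit descent 0 S ≡ + 2 * + rank S - + zeros S * + ones S
  defect₀ S = trans (defect-closed 0 S) (tidy (lead S) (+ 2 * + rank S - + zeros S * + ones S) (+ ones S))
    where
    tidy : ∀ l m n → + 0 * l + m - + 0 * n ≡ m
    tidy = solve-∀

  raise lower : WordFun → WordFun
  raise = hop true unit 0
  lower = hop false descent 0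

  module _ (z k : ℕ) where

    -- Here e is the absolute value of the eigenvalue 2 rank - zk, given by an additive equation to
    -- avoid truncated subtraction. The conditions concern the support because a `WordFun` is
    -- defined on all words.
    Below Above : ℕ → WordFun → Set
    Below e v = ∀ S → v S ≢ + 0 → zeros S ≡ z × ones S ≡ k × e ℕ.+ 2 ℕ.* rank S ≡ z ℕ.* k
    Above e v = ∀ S → v S ≢ + 0 → zeros S ≡ z × ones S ≡ k × e ℕ.+ z ℕ.* k ≡ 2 ℕ.* rank S

    -- The eigenvalue is known only where the function is nonzero; elsewhere both products vanish.
    by-support : ∀ {a b : ℤ} (v : ℤ) → (v ≢ + 0 → a ≡ b) → a * v ≡ b * v
    by-support {a} {b} v eq with v ℤ.≟ + 0
    ... | yes refl = trans (ℤ.*-zeroʳ a) (sym (ℤ.*-zeroʳ b))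
    ... | no  v≢0  = cong (_* v) (eq v≢0)

    raise-injective : ∀ e v → Below (suc e) v → (∀ S → raise v S ≡ + 0) → ∀ S → v S ≡ + 0
    raise-injective = hop-injective true false unit descent Below (z ℕ.* k) bounded step commutator
      where
      bounded : ∀ e v → Below e v → z ℕ.* k ℕ.< e → ∀ S → v S ≡ + 0
      bounded e v supp zk<e S = decidable-stable (v S ℤ.≟ + 0) λ vS≢0 →
        let _ , _ , eq = supp S vS≢0 in
        ℕ.<⇒≱ zk<e (ℕ.≤-trans (ℕ.m≤m+n e _) (ℕ.≤-reflexive eq))
      step : ∀ e v → Below e v → Below (2 ℕ.+ e) (lower v)
      step e v supp S ≢0 =
        let T , s , vT≢0 = hop-support false descent 0 v S ≢0
            zT , kT , eq = supp T vT≢0 in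
        trans (sym (swap-zeros s)) zT , trans (sym (swap-ones s)) kT ,
        trans (shift e (rank S)) (trans (cong (λ r → e ℕ.+ 2 ℕ.* r) (sym (swap-false-rank s))) eq)
        where
        shift : ∀ e r → 2 ℕ.+ e ℕ.+ 2 ℕ.* r ≡ e ℕ.+ 2 ℕ.* suc r
        shift = ℕ-Solver.solve-∀
      commutator : ∀ e v → Below e v → ∀ S → raise (lower v) S ≡ lower (raise v) S - + e * v S
      commutator e v supp S = trans (hop-commutator true unit descent 0 v S)
        (trans (cong (λ t → lower (raise v) S + t) (by-support (v S) coefficient))
               (cong (λ t → lower (raise v) S + t) (sym (ℤ.neg-distribˡ-* (+ e) (v S)))))
        where
        solved : ∀ e r → + 2 * r - (e + + 2 * r) ≡ - e
        solved = solve-∀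
        coefficient : v S ≢ + 0 → defect true unit descent 0 S ≡ - + e
        coefficient vS≢0 with supp S vS≢0
        ... | refl , refl , eq = trans (defect₀ S) (trans
          (cong (λ t → + 2 * + rank S - t)
            (trans (sym (ℤ.pos-* (zeros S) (ones S))) (trans (cong +_ (sym eq))
              (cong (λ t → + e + t) (ℤ.pos-* 2 (rank S))))))
          (solved (+ e) (+ rank S)))

    lower-injective : ∀ e v → Above (suc e) v → (∀ S → lower v S ≡ + 0) → ∀ S → v S ≡ + 0
    lower-injective = hop-injective false true descent unit Above (z ℕ.* k) bounded step commutator
      where
      bounded : ∀ e v → Above e v → z ℕ.* k ℕ.< e → ∀ S → v S ≡ + 0
      bounded e v supp zk<e S = decidable-stable (v S ℤ.≟ + 0) λ vS≢0 →
        case-of (supp S vS≢0)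
        where
        double : ∀ m → 2 ℕ.* m ≡ m ℕ.+ m
        double m = cong (m ℕ.+_) (ℕ.+-identityʳ m)
        case-of : ¬ (zeros S ≡ z × ones S ≡ k × e ℕ.+ z ℕ.* k ≡ 2 ℕ.* rank S)
        case-of (refl , refl , eq) = ℕ.<⇒≱ (ℕ.+-monoˡ-< (z ℕ.* k) zk<e)
          (ℕ.≤-trans (ℕ.≤-reflexive eq) (ℕ.≤-trans (ℕ.*-monoʳ-≤ 2 (rank≤zeros*ones S))
            (ℕ.≤-reflexive (double (z ℕ.* k)))))
      step : ∀ e v → Above e v → Above (2 ℕ.+ e) (raise v)
      step e v supp S ≢0 =
        let T , s , vT≢0 = hop-support true unit 0 v S ≢0
            zT , kT , eq = supp T vT≢0 in
        trans (sym (swap-zeros s)) zT , trans (sym (swap-ones s)) kT ,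
        trans (cong (2 ℕ.+_) eq) (trans (sym (ℕ.*-suc 2 (rank T))) (cong (2 ℕ.*_) (sym (swap-true-rank s))))
      commutator : ∀ e v → Above e v → ∀ S → lower (raise v) S ≡ raise (lower v) S - + e * v S
      -- The roles of the operators are exchanged, which reverses the commutator; above the middle
      -- `defect` is +e, so the sign is again negative.
      commutator e v supp S = sym (trans
        (cong (_- + e * v S) (trans (hop-commutator true unit descent 0 v S)
          (cong (λ t → lower (raise v) S + t) (by-support (v S) coefficient))))
        (cancel (lower (raise v) S) (+ e * v S)))
        where
        cancel : ∀ a b → a + b - b ≡ a
        cancel = solve-∀
        solved : ∀ e t → (e + t) - t ≡ e
        solved = solve-∀
        coefficient : v S ≢ + 0 → defect true unit descent 0 S ≡ + e
        coefficient vS≢0 with supp S vS≢0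
        ... | refl , refl , eq = trans (defect₀ S) (trans
          (cong₂ _-_ (trans (sym (ℤ.pos-* 2 (rank S))) (cong +_ (sym eq)))
                     (sym (ℤ.pos-* (zeros S) (ones S))))
          (solved (+ e) (+ (zeros S ℕ.* ones S))))

  -- Enumeration of words by letters and rank

  delay : ∀ {A : Set} → ℕ → (ℕ → List A) → ℕ → List A
  delay zero    f s       = f s
  delay (suc m) f zero    = []
  delay (suc m) f (suc s) = delay m f s

  -- Recursion on the first letter: a leading one precedes all `suc z` zeros and adds `suc z` to the
  -- rank, which `delay` accounts for as multiplication by a power of q would. `gauss` follows the
  -- same recursion, so the lengths of these lists are its coefficients.
  words : ℕ → ℕ → ℕ → List Word
  words zero    zero    zero    = [] ∷ []
  words zero    zero    (suc s) = []
  words (suc z) zero    s = List.map (false ∷_) (words z zero s)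
  words zero    (suc k) s = List.map (true ∷_) (words zero k s)
  words (suc z) (suc k) s =
    List.map (false ∷_) (words z (suc k) s) ++
    delay (suc z) (λ s → List.map (true ∷_) (words (suc z) k s)) s

  delay-+ : ∀ {A : Set} m (f : ℕ → List A) s → delay m f (m ℕ.+ s) ≡ f s
  delay-+ zero    f s = refl
  delay-+ (suc m) f s = delay-+ m f s

  ∈-delay⁻ : ∀ {A : Set} m (f : ℕ → List A) s {x} → x ∈ delay m f s → ∃ λ r → s ≡ m ℕ.+ r × x ∈ f r
  ∈-delay⁻ zero    f s       x∈ = s , refl , x∈
  ∈-delay⁻ (suc m) f (suc s) x∈ with ∈-delay⁻ m f s x∈
  ... | r , refl , x∈f = r , refl , x∈f

  delay-unique : ∀ {A : Set} m (f : ℕ → List A) s → (∀ r → Unique (f r)) → Unique (delay m f s)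
  delay-unique zero    f s       uniq = uniq s
  delay-unique (suc m) f zero    uniq = []
  delay-unique (suc m) f (suc s) uniq = delay-unique m f s uniq

  words-sound : ∀ z k s {S} → S ∈ words z k s → zeros S ≡ z × ones S ≡ k × rank S ≡ s
  words-sound zero    zero    zero (here refl) = refl , refl , refl
  words-sound (suc z) zero    s S∈ with ∈-map⁻ (false ∷_) S∈
  ... | T , T∈ , refl with words-sound z zero s T∈
  ...   | zT , kT , rT = cong suc zT , kT , rT
  words-sound zero    (suc k) s S∈ with ∈-map⁻ (true ∷_) S∈
  ... | T , T∈ , refl with words-sound zero k s T∈
  ...   | zT , kT , rT = zT , cong suc kT , cong₂ ℕ._+_ zT rT
  words-sound (suc z) (suc k) s S∈ with ∈-++⁻ (List.map (false ∷_) (words z (suc k) s)) S∈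
  words-sound (suc z) (suc k) s S∈ | inj₁ S∈ˡ with ∈-map⁻ (false ∷_) S∈ˡ
  ... | T , T∈ , refl with words-sound z (suc k) s T∈
  ...   | zT , kT , rT = cong suc zT , kT , rT
  words-sound (suc z) (suc k) s S∈ | inj₂ S∈ʳ
    with ∈-delay⁻ (suc z) (λ s → List.map (true ∷_) (words (suc z) k s)) s S∈ʳ
  ... | r , refl , S∈ʳ′ with ∈-map⁻ (true ∷_) S∈ʳ′
  ...   | T , T∈ , refl with words-sound (suc z) k r T∈
  ...     | zT , kT , rT = zT , cong suc kT , cong₂ ℕ._+_ zT rT

  words-complete : ∀ S z k s → zeros S ≡ z → ones S ≡ k → rank S ≡ s → S ∈ words z k s
  words-complete []          _       _       _ refl refl refl = here refl
  words-complete (false ∷ S) (suc z) zero    s zS kS rS =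
    ∈-map⁺ (false ∷_) (words-complete S z zero s (ℕ.suc-injective zS) kS rS)
  words-complete (false ∷ S) (suc z) (suc k) s zS kS rS =
    ∈-++⁺ˡ (∈-map⁺ (false ∷_) (words-complete S z (suc k) s (ℕ.suc-injective zS) kS rS))
  words-complete (true ∷ S)  zero    (suc k) s zS kS rS =
    ∈-map⁺ (true ∷_) (words-complete S zero k s zS (ℕ.suc-injective kS)
      (trans (sym (cong (ℕ._+ rank S) zS)) rS))
  words-complete (true ∷ S)  (suc z) (suc k) s zS kS refl =
    ∈-++⁺ʳ (List.map (false ∷_) (words z (suc k) s)) (subst (true ∷ S ∈_)
      (sym (trans (cong (λ m → delay (suc z) ws (m ℕ.+ rank S)) zS) (delay-+ (suc z) ws (rank S))))
      (∈-map⁺ (true ∷_) (words-complete S (suc z) k (rank S) zS (ℕ.suc-injective kS) refl)))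
    where ws = λ s → List.map (true ∷_) (words (suc z) k s)

  words-unique : ∀ z k s → Unique (words z k s)
  words-unique zero    zero    zero    = [] ∷ []
  words-unique zero    zero    (suc s) = []
  words-unique (suc z) zero    s = Unique.map⁺ List.∷-injectiveʳ (words-unique z zero s)
  words-unique zero    (suc k) s = Unique.map⁺ List.∷-injectiveʳ (words-unique zero k s)
  words-unique (suc z) (suc k) s = Unique.++⁺
    (Unique.map⁺ List.∷-injectiveʳ (words-unique z (suc k) s))
    (delay-unique (suc z) ws s (λ r → Unique.map⁺ List.∷-injectiveʳ (words-unique (suc z) k r)))
    disjoint
    where
    ws = λ s → List.map (true ∷_) (words (suc z) k s)
    disjoint : ∀ {S} → ¬ (S ∈ List.map (false ∷_) (words z (suc k) s) × S ∈ delay (suc z) ws s)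
    disjoint (S∈ˡ , S∈ʳ) with ∈-map⁻ (false ∷_) S∈ˡ | ∈-delay⁻ (suc z) ws s S∈ʳ
    ... | T , _ , refl | r , _ , S∈ʳ′ with ∈-map⁻ (true ∷_) S∈ʳ′
    ...   | _ , _ , ()

  #words : ℕ → ℕ → ℕ → ℕ
  #words z k s = length (words z k s)

  #words-increasing : ∀ z k s → 2 ℕ.* s ℕ.< z ℕ.* k → #words z k s ℕ.≤ #words z k (suc s)
  #words-increasing z k s 2s<zk =
    hop-injective⇒≤ true unit 0 (words z k s) (words z k (suc s)) (words-unique z k s) injective
    where
    -- `suc e` is zk - 2s, the distance of rank s from the middle, positive by hypothesis.
    e = z ℕ.* k ℕ.∸ suc (2 ℕ.* s)
    injective : ∀ v → (∀ S → v S ≢ + 0 → S ∈ words z k s) →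
      (∀ T → T ∈ words z k (suc s) → raise v T ≡ + 0) → ∀ S → v S ≡ + 0
    -- Outside `words z k (suc s)` the image vanishes anyway: a nonzero value at T comes from a swap
    -- with a word of the support, which forces the letters and the rank of T.
    injective v supp vanish = raise-injective z k e v below λ T →
      decidable-stable (raise v T ℤ.≟ + 0) λ ≢0 →
        let S , swap , vS≢0 = hop-support true unit 0 v T ≢0
            zS , kS , rS = words-sound z k s (supp S vS≢0) in
        ≢0 (vanish T (words-complete T z k (suc s) (trans (sym (swap-zeros swap)) zS)
          (trans (sym (swap-ones swap)) kS) (trans (swap-true-rank swap) (cong suc rS))))
      where
      below : Below z k (suc e) v
      below S vS≢0 = let zS , kS , rS = words-sound z k s (supp S vS≢0) in
        zS , kS , trans (cong (λ r → suc e ℕ.+ 2 ℕ.* r) rS)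
          (trans (sym (ℕ.+-suc e (2 ℕ.* s))) (ℕ.m∸n+n≡m 2s<zk))

  #words-decreasing : ∀ z k s → z ℕ.* k ℕ.< 2 ℕ.* suc s → #words z k (suc s) ℕ.≤ #words z k s
  #words-decreasing z k s zk<2s =
    hop-injective⇒≤ false descent 0 (words z k (suc s)) (words z k s) (words-unique z k (suc s)) injective
    where
    -- Now `suc e` is 2(s+1) - zk, the distance of rank s+1 on the upper side.
    e = 2 ℕ.* suc s ℕ.∸ suc (z ℕ.* k)
    injective : ∀ v → (∀ S → v S ≢ + 0 → S ∈ words z k (suc s)) →
      (∀ T → T ∈ words z k s → lower v T ≡ + 0) → ∀ S → v S ≡ + 0
    injective v supp vanish = lower-injective z k e v above λ T →
      decidable-stable (lower v T ℤ.≟ + 0) λ ≢0 →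
        let S , swap , vS≢0 = hop-support false descent 0 v T ≢0
            zS , kS , rS = words-sound z k (suc s) (supp S vS≢0) in
        ≢0 (vanish T (words-complete T z k s (trans (sym (swap-zeros swap)) zS)
          (trans (sym (swap-ones swap)) kS) (ℕ.suc-injective (trans (sym (swap-false-rank swap)) rS))))
      where
      above : Above z k (suc e) v
      above S vS≢0 = let zS , kS , rS = words-sound z k (suc s) (supp S vS≢0) in
        zS , kS , trans (sym (ℕ.+-suc e (z ℕ.* k)))
          (trans (ℕ.m∸n+n≡m zk<2s) (cong (2 ℕ.*_) (sym rS)))

open Unimodality using (delay; words; #words; #words-increasing; #words-decreasing)

-- Gaussian polynomials

open import Data.Nat using (_+_; _*_; _<_; _≤_)

module RingIdentities {c ℓ} (R : CommutativeRing c ℓ) where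
  open CommutativeRing R using (_≈_; distribʳ; *-assoc; +-congˡ; -‿cong)
    renaming (_+_ to _⊕_; _*_ to _⊗_; -_ to ⊖_; refl to ≈-refl; sym to ≈-sym; trans to ≈-trans)
  open import Algebra.Properties.Ring (CommutativeRing.ring R) using (-‿distribˡ-*)
  open import Algebra.Solver.Ring.NaturalCoefficients.Default (CommutativeRing.commutativeSemiring R)
    using (solve; _:=_; _:+_; _:*_)

  pascal-split : ∀ x u w G H Pz Pk → (G ⊕ x ⊗ H) ⊗ (u ⊗ Pz) ⊗ (w ⊗ Pk) ≈
    u ⊗ (G ⊗ Pz ⊗ (w ⊗ Pk)) ⊕ x ⊗ w ⊗ (H ⊗ (u ⊗ Pz) ⊗ Pk)
  pascal-split = solve 7 (λ x u w G H Pz Pk →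
    (G :+ x :* H) :* (u :* Pz) :* (w :* Pk) :=
    u :* (G :* Pz :* (w :* Pk)) :+ x :* w :* (H :* (u :* Pz) :* Pk)) ≈-refl

  factor-out : ∀ u v P → u ⊗ P ⊕ v ⊗ P ≈ (u ⊕ v) ⊗ P
  factor-out = solve 3 (λ u v P → u :* P :+ v :* P := (u :+ v) :* P) ≈-refl

  sum-quotient : ∀ Q s Q′ D → (Q ⊕ s ⊗ Q′) ⊗ D ≈ Q ⊗ D ⊕ s ⊗ (Q′ ⊗ D)
  sum-quotient = solve 4 (λ Q s Q′ D → (Q :+ s :* Q′) :* D := Q :* D :+ s :* (Q′ :* D)) ≈-refl

  difference-quotient : ∀ Q s Q′ D → (Q ⊕ ⊖ (s ⊗ Q′)) ⊗ D ≈ Q ⊗ D ⊕ ⊖ (s ⊗ (Q′ ⊗ D))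
  difference-quotient Q s Q′ D = ≈-trans (distribʳ D Q (⊖ (s ⊗ Q′)))
    (+-congˡ (≈-trans (≈-sym (-‿distribˡ-* (s ⊗ Q′) D)) (-‿cong (*-assoc s Q′ D))))

  group-left : ∀ g G Pz Pk → g ⊗ G ⊗ Pz ⊗ Pk ≈ g ⊗ (G ⊗ Pz ⊗ Pk)
  group-left = solve 4 (λ g G Pz Pk → g :* G :* Pz :* Pk := g :* (G :* Pz :* Pk)) ≈-refl

  pull-front : ∀ G u Pz Pk → u ⊗ G ⊗ Pk ⊗ Pz ≈ G ⊗ Pz ⊗ (u ⊗ Pk)
  pull-front = solve 4 (λ G u Pz Pk → u :* G :* Pk :* Pz := G :* Pz :* (u :* Pk)) ≈-refl

  pull-last : ∀ G u Pz Pk → G ⊗ (u ⊗ Pz) ⊗ Pk ≈ u ⊗ (G ⊗ Pz ⊗ Pk)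
  pull-last = solve 4 (λ G u Pz Pk → G :* (u :* Pz) :* Pk := u :* (G :* Pz :* Pk)) ≈-refl

  pull-last′ : ∀ G u Pz Pk → G ⊗ Pz ⊗ (u ⊗ Pk) ≈ u ⊗ (G ⊗ Pz ⊗ Pk)
  pull-last′ = solve 4 (λ G u Pz Pk → G :* Pz :* (u :* Pk) := u :* (G :* Pz :* Pk)) ≈-refl

  pull-second : ∀ D H Pz Pk → D ⊗ (H ⊗ Pz ⊗ Pk) ≈ H ⊗ D ⊗ Pk ⊗ Pz
  pull-second = solve 4 (λ D H Pz Pk → D :* (H :* Pz :* Pk) := H :* D :* Pk :* Pz) ≈-refl

  collect : ∀ Q u Pk Pm D → Q ⊗ u ⊗ Pk ⊗ Pm ⊗ D ≈ Q ⊗ D ⊗ Pk ⊗ (u ⊗ Pm)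
  collect = solve 5 (λ Q u Pk Pm D → Q :* u :* Pk :* Pm :* D := Q :* D :* Pk :* (u :* Pm)) ≈-refl

  rotate : ∀ g D P → g ⊗ (D ⊗ P) ≈ g ⊗ P ⊗ D
  rotate = solve 3 (λ g D P → g :* (D :* P) := g :* P :* D) ≈-refl

open RingIdentities polyRing
module Pₚ = CommutativeRing polyRing
open import Relation.Binary.Reasoning.Setoid Pₚ.setoid

-- Powers of q and cancellation of 1 - q^m

coeff-- : ∀ p r i → coeff (p -ₚ r) i ≡ coeff p i ℤ.- coeff r i
coeff-- p r i = trans (coeff-+ p (negₚ r) i) (cong (λ x → coeff p i ℤ.+ x) (coeff-neg r i))

shifted : ℕ → Poly → Poly
shifted m p = replicate m (+ 0) ++ p

qpow-* : ∀ m p → qpow m *ₚ p ≈ₚ shifted m p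
qpow-* zero    p = *ₚ-identityˡ p
qpow-* (suc m) p i = trans (shift-*ₚ (qpow m) p i) (step i)
  where
  step : (+ 0 ∷ qpow m *ₚ p) ≈ₚ (+ 0 ∷ shifted m p)
  step zero    = refl
  step (suc i) = qpow-* m p i

shifted-qpow : ∀ m n → shifted m (qpow n) ≡ qpow (m + n)
shifted-qpow zero    n = refl
shifted-qpow (suc m) n = cong (+ 0 ∷_) (shifted-qpow m n)

qpow-+ : ∀ m n → qpow (m + n) ≈ₚ qpow m *ₚ qpow n
qpow-+ m n i = sym (trans (qpow-* m (qpow n) i) (cong (λ p → coeff p i) (shifted-qpow m n)))

coeff-shifted-< : ∀ {m i} p → i < m → coeff (shifted m p) i ≡ + 0
coeff-shifted-< {suc m} {zero}  p _            = refl
coeff-shifted-< {suc m} {suc i} p (ℕ.s≤s i<m) = coeff-shifted-< p i<m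

coeff-shifted-+ : ∀ m p j → coeff (shifted m p) (m + j) ≡ coeff p j
coeff-shifted-+ zero    p j = refl
coeff-shifted-+ (suc m) p j = coeff-shifted-+ m p j

1-q^-+ : ∀ m n → 1-q^ (m + n) ≈ₚ 1-q^ m +ₚ qpow m *ₚ 1-q^ n
1-q^-+ m n i = sym (≡.begin
  coeff (1-q^ m +ₚ qpow m *ₚ 1-q^ n) i
    ≡.≡⟨ coeff-+ (1-q^ m) (qpow m *ₚ 1-q^ n) i ⟩
  coeff (1-q^ m) i ℤ.+ coeff (qpow m *ₚ 1-q^ n) i
    ≡.≡⟨ cong₂ ℤ._+_ (coeff-- oneₚ (qpow m) i) (≡.begin
      coeff (qpow m *ₚ 1-q^ n) i
        ≡.≡⟨ x[y-z]≈xy-xz (qpow m) oneₚ (qpow n) i ⟩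
      coeff (qpow m *ₚ oneₚ -ₚ qpow m *ₚ qpow n) i
        ≡.≡⟨ coeff-- (qpow m *ₚ oneₚ) (qpow m *ₚ qpow n) i ⟩
      coeff (qpow m *ₚ oneₚ) i ℤ.- coeff (qpow m *ₚ qpow n) i
        ≡.≡⟨ cong₂ ℤ._-_ (Pₚ.*-identityʳ (qpow m) i) (sym (qpow-+ m n i)) ⟩
      coeff (qpow m) i ℤ.- coeff (qpow (m + n)) i ≡.∎) ⟩
  (coeff oneₚ i ℤ.- coeff (qpow m) i) ℤ.+ (coeff (qpow m) i ℤ.- coeff (qpow (m + n)) i)
    ≡.≡⟨ telescope (coeff oneₚ i) (coeff (qpow m) i) (coeff (qpow (m + n)) i) ⟩
  coeff oneₚ i ℤ.- coeff (qpow (m + n)) i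
    ≡.≡⟨ coeff-- oneₚ (qpow (m + n)) i ⟨
  coeff (1-q^ (m + n)) i ≡.∎)
  where
  module ≡ = ≡-Reasoning
  open import Algebra.Properties.Ring Pₚ.ring using (x[y-z]≈xy-xz)
  telescope : ∀ a b c → (a ℤ.- b) ℤ.+ (b ℤ.- c) ≡ a ℤ.- c
  telescope = solve-∀

coeff-1-q^-* : ∀ m p i → coeff (1-q^ m *ₚ p) i ≡ coeff p i ℤ.- coeff (shifted m p) i
coeff-1-q^-* m p i = trans ([y-z]x≈yx-zx p oneₚ (qpow m) i)
  (trans (coeff-- (oneₚ *ₚ p) (qpow m *ₚ p) i) (cong₂ ℤ._-_ (*ₚ-identityˡ p i) (qpow-* m p i)))
  where open import Algebra.Properties.Ring Pₚ.ring using ([y-z]x≈yx-zx)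

split-< : ∀ m i → i < m ⊎ ∃ λ j → i ≡ m + j
split-< m i with i ℕ.<? m
... | yes i<m = inj₁ i<m
... | no  i≮m = inj₂ (i ℕ.∸ m , sym (ℕ.m+[n∸m]≡n (ℕ.≮⇒≥ i≮m)))

-- The constant term of 1 - q^(m+1) is 1, so the product determines each coefficient of `p` from
-- strictly earlier ones. The exponent is a successor because 1 - q^0 = 0.
1-q^-cancelʳ : ∀ m p r → p *ₚ 1-q^ (suc m) ≈ₚ r *ₚ 1-q^ (suc m) → p ≈ₚ r
1-q^-cancelʳ m p r eq = <-rec _ step
  where
  open import Algebra.Properties.AbelianGroup ℤ.+-0-abelianGroup using () renaming (∙-cancelʳ to +-cancelʳ)
  shift-agrees : ∀ i → coeff p i ℤ.- coeff (shifted (suc m) p) i ≡ coeff r i ℤ.- coeff (shifted (suc m) r) i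
  shift-agrees i = trans (sym (coeff-1-q^-* (suc m) p i)) (trans (*ₚ-comm (1-q^ (suc m)) p i)
    (trans (eq i) (trans (*ₚ-comm r (1-q^ (suc m)) i) (coeff-1-q^-* (suc m) r i))))
  earlier : ∀ i → (∀ {j} → j < i → coeff p j ≡ coeff r j) →
    coeff (shifted (suc m) p) i ≡ coeff (shifted (suc m) r) i
  earlier i rec with split-< (suc m) i
  ... | inj₁ i<m = trans (coeff-shifted-< p i<m) (sym (coeff-shifted-< r i<m))
  ... | inj₂ (j , refl) = trans (coeff-shifted-+ (suc m) p j)
    (trans (rec (ℕ.s≤s (ℕ.m≤n+m j m))) (sym (coeff-shifted-+ (suc m) r j)))
  step : ∀ i → (∀ {j} → j < i → coeff p j ≡ coeff r j) → coeff p i ≡ coeff r i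
  step i rec = +-cancelʳ (ℤ.- coeff (shifted (suc m) p) i) (coeff p i) (coeff r i)
    (trans (shift-agrees i) (cong (λ t → coeff r i ℤ.- t) (sym (earlier i rec))))

qPoch-cancelʳ : ∀ m p r → p *ₚ qPoch m ≈ₚ r *ₚ qPoch m → p ≈ₚ r
qPoch-cancelʳ zero    p r eq = begin
  p          ≈⟨ Pₚ.*-identityʳ p ⟨
  p *ₚ oneₚ  ≈⟨ eq ⟩
  r *ₚ oneₚ  ≈⟨ Pₚ.*-identityʳ r ⟩
  r          ∎
qPoch-cancelʳ (suc m) p r eq = 1-q^-cancelʳ m p r (qPoch-cancelʳ m (p *ₚ 1-q^ (suc m)) (r *ₚ 1-q^ (suc m)) (begin
  p *ₚ 1-q^ (suc m) *ₚ qPoch m    ≈⟨ *ₚ-assoc p (1-q^ (suc m)) (qPoch m) ⟩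
  p *ₚ (1-q^ (suc m) *ₚ qPoch m)  ≈⟨ eq ⟩
  r *ₚ (1-q^ (suc m) *ₚ qPoch m)  ≈⟨ *ₚ-assoc r (1-q^ (suc m)) (qPoch m) ⟨
  r *ₚ 1-q^ (suc m) *ₚ qPoch m    ∎))

-- The Gaussian polynomial [z+k; k], given by the q-Pascal rule instead of a quotient, so that it is
-- a polynomial from the outset and counts words.
gauss : ℕ → ℕ → Poly
gauss zero    zero    = oneₚ
gauss (suc z) zero    = gauss z zero
gauss zero    (suc k) = gauss zero k
gauss (suc z) (suc k) = gauss z (suc k) +ₚ qpow (suc z) *ₚ gauss (suc z) k

coeff-shifted-delay : ∀ {A : Set} m p (f : ℕ → List A) → (∀ s → coeff p s ≡ + length (f s)) →
  ∀ s → coeff (shifted m p) s ≡ + length (delay m f s)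
coeff-shifted-delay zero    p f eq s       = eq s
coeff-shifted-delay (suc m) p f eq zero    = refl
coeff-shifted-delay (suc m) p f eq (suc s) = coeff-shifted-delay m p f eq s

coeff-gauss : ∀ z k s → coeff (gauss z k) s ≡ + #words z k s
coeff-gauss zero    zero    zero    = refl
coeff-gauss zero    zero    (suc s) = refl
coeff-gauss (suc z) zero    s =
  trans (coeff-gauss z zero s) (cong +_ (sym (List.length-map (false ∷_) (words z zero s))))
coeff-gauss zero    (suc k) s =
  trans (coeff-gauss zero k s) (cong +_ (sym (List.length-map (true ∷_) (words zero k s))))
coeff-gauss (suc z) (suc k) s = ≡.begin
  coeff (gauss z (suc k) +ₚ qpow (suc z) *ₚ gauss (suc z) k) s
    ≡.≡⟨ coeff-+ (gauss z (suc k)) _ s ⟩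
  coeff (gauss z (suc k)) s ℤ.+ coeff (qpow (suc z) *ₚ gauss (suc z) k) s
    ≡.≡⟨ cong₂ ℤ._+_
         (trans (coeff-gauss z (suc k) s) (cong +_ (sym (List.length-map (false ∷_) (words z (suc k) s)))))
         (trans (qpow-* (suc z) (gauss (suc z) k) s)
           (coeff-shifted-delay (suc z) (gauss (suc z) k) tails
             (λ r → trans (coeff-gauss (suc z) k r)
                      (cong +_ (sym (List.length-map (true ∷_) (words (suc z) k r))))) s)) ⟩
  + (length heads + length (delay (suc z) tails s))
    ≡.≡⟨ cong +_ (List.length-++ heads) ⟨
  + #words (suc z) (suc k) s ≡.∎
  where
  module ≡ = ≡-Reasoning
  heads = map (false ∷_) (words z (suc k) s)
  tails = λ s → map (true ∷_) (words (suc z) k s)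

-- This ties the recursive definition to the product formula. By induction both Pascal terms are
-- multiples of `qPoch (z + suc k)`, and their factors add up by (1 - q^(z+1)) + q^(z+1) (1 -
-- q^(k+1)) = 1 - q^(z+k+2).
gauss-qPoch : ∀ z k → gauss z k *ₚ qPoch z *ₚ qPoch k ≈ₚ qPoch (z + k)
gauss-qPoch zero    zero    = begin
  oneₚ *ₚ oneₚ *ₚ oneₚ  ≈⟨ (λ i → refl) ⟩
  oneₚ                  ∎
gauss-qPoch (suc z) zero    = begin
  gauss z 0 *ₚ (1-q^ (suc z) *ₚ qPoch z) *ₚ oneₚ    ≈⟨ pull-last (gauss z 0) (1-q^ (suc z)) (qPoch z) oneₚ ⟩
  1-q^ (suc z) *ₚ (gauss z 0 *ₚ qPoch z *ₚ oneₚ)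
    ≈⟨ *ₚ-congˡ (1-q^ (suc z)) {gauss z 0 *ₚ qPoch z *ₚ oneₚ} {qPoch (z + 0)} (gauss-qPoch z 0) ⟩
  1-q^ (suc z) *ₚ qPoch (z + 0)
    ≡⟨ cong (λ n → 1-q^ (suc n) *ₚ qPoch (z + 0)) (ℕ.+-identityʳ z) ⟨
  qPoch (suc z + 0)                                 ∎
gauss-qPoch zero    (suc k) = begin
  gauss 0 k *ₚ oneₚ *ₚ (1-q^ (suc k) *ₚ qPoch k)    ≈⟨ pull-last′ (gauss 0 k) (1-q^ (suc k)) oneₚ (qPoch k) ⟩
  1-q^ (suc k) *ₚ (gauss 0 k *ₚ oneₚ *ₚ qPoch k)
    ≈⟨ *ₚ-congˡ (1-q^ (suc k)) {gauss 0 k *ₚ oneₚ *ₚ qPoch k} {qPoch k} (gauss-qPoch 0 k) ⟩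
  qPoch (suc k)                                     ∎
gauss-qPoch (suc z) (suc k) = begin
  (gauss z (suc k) +ₚ x *ₚ gauss (suc z) k) *ₚ (1-q^ (suc z) *ₚ qPoch z) *ₚ (1-q^ (suc k) *ₚ qPoch k)
    ≈⟨ pascal-split x (1-q^ (suc z)) (1-q^ (suc k)) (gauss z (suc k)) (gauss (suc z) k) (qPoch z) (qPoch k) ⟩
  1-q^ (suc z) *ₚ (gauss z (suc k) *ₚ qPoch z *ₚ qPoch (suc k))
    +ₚ x *ₚ 1-q^ (suc k) *ₚ (gauss (suc z) k *ₚ qPoch (suc z) *ₚ qPoch k)
    ≈⟨ +ₚ-cong {1-q^ (suc z) *ₚ (gauss z (suc k) *ₚ qPoch z *ₚ qPoch (suc k))} {1-q^ (suc z) *ₚ P}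
         {x *ₚ 1-q^ (suc k) *ₚ (gauss (suc z) k *ₚ qPoch (suc z) *ₚ qPoch k)} {x *ₚ 1-q^ (suc k) *ₚ P}
         (*ₚ-congˡ (1-q^ (suc z)) {gauss z (suc k) *ₚ qPoch z *ₚ qPoch (suc k)} {P} (gauss-qPoch z (suc k)))
         (*ₚ-congˡ (x *ₚ 1-q^ (suc k))
             {gauss (suc z) k *ₚ qPoch (suc z) *ₚ qPoch k} {P} (λ i → trans (gauss-qPoch (suc z) k i)
           (cong (λ n → coeff (qPoch n) i) (sym (ℕ.+-suc z k))))) ⟩
  1-q^ (suc z) *ₚ P +ₚ x *ₚ 1-q^ (suc k) *ₚ P
    ≈⟨ factor-out (1-q^ (suc z)) (x *ₚ 1-q^ (suc k)) P ⟩
  (1-q^ (suc z) +ₚ x *ₚ 1-q^ (suc k)) *ₚ P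
    ≈⟨ *ₚ-cong {1-q^ (suc z) +ₚ x *ₚ 1-q^ (suc k)} {1-q^ (suc z + suc k)} {P} {P}
         (λ i → sym (1-q^-+ (suc z) (suc k) i)) (λ _ → refl) ⟩
  qPoch (suc z + suc k) ∎
  where
  x = qpow (suc z)
  P = qPoch (z + suc k)

-- Both sides become `qPoch (suc (z + k))` after multiplication by `qPoch k` and `qPoch z`. It
-- supplies an explicit quotient for the divisibility of (1 - q^(k+1)) G by 1 - q^(z+k+1).
gauss-absorption : ∀ z k → 1-q^ (suc k) *ₚ gauss z (suc k) ≈ₚ gauss z k *ₚ 1-q^ (suc (z + k))
gauss-absorption z k = qPoch-cancelʳ k lhs rhs (qPoch-cancelʳ z (lhs *ₚ qPoch k) (rhs *ₚ qPoch k) (begin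
  1-q^ (suc k) *ₚ gauss z (suc k) *ₚ qPoch k *ₚ qPoch z
    ≈⟨ pull-front (gauss z (suc k)) (1-q^ (suc k)) (qPoch z) (qPoch k) ⟩
  gauss z (suc k) *ₚ qPoch z *ₚ qPoch (suc k)
    ≈⟨ gauss-qPoch z (suc k) ⟩
  qPoch (z + suc k)
    ≡⟨ cong qPoch (ℕ.+-suc z k) ⟩
  1-q^ (suc (z + k)) *ₚ qPoch (z + k)
    ≈⟨ *ₚ-congˡ (1-q^ (suc (z + k))) {gauss z k *ₚ qPoch z *ₚ qPoch k} {qPoch (z + k)} (gauss-qPoch z k) ⟨
  1-q^ (suc (z + k)) *ₚ (gauss z k *ₚ qPoch z *ₚ qPoch k)
    ≈⟨ pull-second (1-q^ (suc (z + k))) (gauss z k) (qPoch z) (qPoch k) ⟩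
  gauss z k *ₚ 1-q^ (suc (z + k)) *ₚ qPoch k *ₚ qPoch z ∎))
  where
  lhs = 1-q^ (suc k) *ₚ gauss z (suc k)
  rhs = gauss z k *ₚ 1-q^ (suc (z + k))

-- The x for which D divides (1 - q^x) G are closed under addition and cancellation because
-- 1 - q^(x+y) = (1 - q^x) + q^x (1 - q^y); hence they are closed under gcd.
module _ (D G : Poly) where

  Cleared : ℕ → Set
  Cleared x = Σ Poly λ Q → Q *ₚ D ≈ₚ 1-q^ x *ₚ G

  private
    split : ∀ x y → 1-q^ (x + y) *ₚ G ≈ₚ 1-q^ x *ₚ G +ₚ qpow x *ₚ (1-q^ y *ₚ G)
    split x y = begin
      1-q^ (x + y) *ₚ G
        ≈⟨ *ₚ-cong {1-q^ (x + y)} {1-q^ x +ₚ qpow x *ₚ 1-q^ y} {G} {G} (1-q^-+ x y) (λ _ → refl) ⟩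
      (1-q^ x +ₚ qpow x *ₚ 1-q^ y) *ₚ G
        ≈⟨ sum-quotient (1-q^ x) (qpow x) (1-q^ y) G ⟩
      1-q^ x *ₚ G +ₚ qpow x *ₚ (1-q^ y *ₚ G) ∎

  cleared-0 : Cleared 0
  cleared-0 = [] , λ i → sym (trans (coeff-1-q^-* 0 G i) (ℤ.+-inverseʳ (coeff G i)))

  cleared-+ : ∀ x y → Cleared x → Cleared y → Cleared (x + y)
  cleared-+ x y (Q , eq) (Q′ , eq′) = Q +ₚ qpow x *ₚ Q′ , (begin
    (Q +ₚ qpow x *ₚ Q′) *ₚ D                ≈⟨ sum-quotient Q (qpow x) Q′ D ⟩
    Q *ₚ D +ₚ qpow x *ₚ (Q′ *ₚ D)
      ≈⟨ +ₚ-cong {Q *ₚ D} {1-q^ x *ₚ G} {qpow x *ₚ (Q′ *ₚ D)}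
           {qpow x *ₚ (1-q^ y *ₚ G)} eq (*ₚ-congˡ (qpow x) {Q′ *ₚ D} {1-q^ y *ₚ G} eq′) ⟩
    1-q^ x *ₚ G +ₚ qpow x *ₚ (1-q^ y *ₚ G)  ≈⟨ split x y ⟨
    1-q^ (x + y) *ₚ G                       ∎)

  cleared-cancel : ∀ x y → Cleared (x + y) → Cleared y → Cleared x
  cleared-cancel x y (Q , eq) (Q′ , eq′) = Q -ₚ qpow x *ₚ Q′ , λ i → ≡.begin
    coeff ((Q -ₚ qpow x *ₚ Q′) *ₚ D) i
      ≡.≡⟨ difference-quotient Q (qpow x) Q′ D i ⟩
    coeff (Q *ₚ D -ₚ qpow x *ₚ (Q′ *ₚ D)) i
      ≡.≡⟨ coeff-- (Q *ₚ D) (qpow x *ₚ (Q′ *ₚ D)) i ⟩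
    coeff (Q *ₚ D) i ℤ.- coeff (qpow x *ₚ (Q′ *ₚ D)) i
      ≡.≡⟨ cong₂ ℤ._-_ (trans (eq i) (trans (split x y i) (coeff-+ (1-q^ x *ₚ G) _ i)))
             (*ₚ-congˡ (qpow x) {Q′ *ₚ D} {1-q^ y *ₚ G} eq′ i) ⟩
    coeff (1-q^ x *ₚ G) i ℤ.+ t i ℤ.- t i
      ≡.≡⟨ cancel (coeff (1-q^ x *ₚ G) i) (t i) ⟩
    coeff (1-q^ x *ₚ G) i ≡.∎
    where
    module ≡ = ≡-Reasoning
    t = coeff (qpow x *ₚ (1-q^ y *ₚ G))
    cancel : ∀ a b → a ℤ.+ b ℤ.- b ≡ a
    cancel = solve-∀

  cleared-* : ∀ c x → Cleared x → Cleared (c * x)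
  cleared-* zero    x d = cleared-0
  cleared-* (suc c) x d = cleared-+ x (c * x) d (cleared-* c x d)

  -- Bézout over ℕ has the form gcd + yn = xm or gcd + xm = yn, which needs multiples and
  -- cancellation but no negative exponents.
  cleared-gcd : ∀ m n → Cleared m → Cleared n → Cleared (gcd m n)
  cleared-gcd m n dm dn with Bézout.identity (gcd-GCD m n)
  ... | Bézout.+- x y eq = cleared-cancel (gcd m n) (y * n)
          (subst Cleared (sym eq) (cleared-* x m dm)) (cleared-* y n dn)
  ... | Bézout.-+ x y eq = cleared-cancel (gcd m n) (x * m)
          (subst Cleared (sym eq) (cleared-* y n dn)) (cleared-* x m dm)

-- Nonnegativity of the quotient

#words-increasing* : ∀ z k d j → 2 * (d + j) ≤ z * k → #words z k j ≤ #words z k (d + j)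
#words-increasing* z k zero    j le = ℕ.≤-refl
#words-increasing* z k (suc d) j le =
  ℕ.≤-trans (#words-increasing* z k d j (ℕ.<⇒≤ lt)) (#words-increasing z k (d + j) lt)
  where
  lt : 2 * (d + j) < z * k
  lt = ℕ.<-≤-trans (ℕ.*-monoʳ-< 2 (ℕ.n<1+n (d + j))) le

#words-decreasing* : ∀ z k d j → z * k ≤ 2 * j → #words z k (d + j) ≤ #words z k j
#words-decreasing* z k zero    j le = ℕ.≤-refl
#words-decreasing* z k (suc d) j le =
  ℕ.≤-trans (#words-decreasing z k (d + j)
              (ℕ.≤-<-trans le (ℕ.*-monoʳ-< 2 (ℕ.s≤s (ℕ.m≤n+m j d)))))
            (#words-decreasing* z k d j le)

coeff-beyond : ∀ p {i} → length p ≤ i → coeff p i ≡ + 0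
coeff-beyond []      _            = refl
coeff-beyond (c ∷ p) (ℕ.s≤s le) = coeff-beyond p le

-- Writing N as g + N′ encodes g ≤ N: the increment at N+j compares degrees g+(N′+j) and N′+j, both
-- past the middle as soon as j is. Positivity of N makes both recursions progress.
module _ (z k g N′ : ℕ) (0<N : 0 < g + N′) (Q : Poly)
  (eq : Q *ₚ 1-q^ (g + N′) ≈ₚ 1-q^ g *ₚ gauss z k) where

  private
    N : ℕ
    N = g + N′
    w : ℕ → ℕ
    w = #words z k
    jump : ℕ → ℤ
    jump i = coeff (1-q^ g *ₚ gauss z k) i

    jump-+ : ∀ j → jump (g + j) ≡ + w (g + j) ℤ.- + w j
    jump-+ j = trans (coeff-1-q^-* g (gauss z k) (g + j)) (cong₂ ℤ._-_ (coeff-gauss z k (g + j))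
      (trans (coeff-shifted-+ g (gauss z k) j) (coeff-gauss z k j)))

    recurrence : ∀ i → coeff Q i ≡ jump i ℤ.+ coeff (shifted N Q) i
    recurrence i = trans (sym (undo (coeff Q i) (coeff (shifted N Q) i)))
      (cong (ℤ._+ coeff (shifted N Q) i)
        (trans (sym (coeff-1-q^-* N Q i)) (trans (*ₚ-comm (1-q^ N) Q i) (eq i))))
      where
      undo : ∀ a b → a ℤ.- b ℤ.+ b ≡ a
      undo = solve-∀

    jump-rising : ∀ i → 2 * i ≤ z * k → + 0 ℤ.≤ jump i
    jump-rising i le with split-< g i
    -- Below degree g nothing is subtracted, and the increment is a coefficient of G itself.
    ... | inj₁ i<g = subst (+ 0 ℤ.≤_) (sym (trans (coeff-1-q^-* g (gauss z k) i)
      (trans (cong₂ ℤ._-_ (coeff-gauss z k i) (coeff-shifted-< (gauss z k) i<g)) (ℤ.+-identityʳ _))))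
      (ℤ.+≤+ ℕ.z≤n)
    ... | inj₂ (j , refl) = subst (+ 0 ℤ.≤_) (sym (jump-+ j))
      (ℤ.i≤j⇒0≤j-i (ℤ.+≤+ (#words-increasing* z k g j le)))

    rising : ∀ i → 2 * i ≤ z * k → + 0 ℤ.≤ coeff Q i
    rising = <-rec _ step
      where
      step : ∀ i → (∀ {j} → j < i → 2 * j ≤ z * k → + 0 ℤ.≤ coeff Q j) →
        2 * i ≤ z * k → + 0 ℤ.≤ coeff Q i
      step i rec le = subst (+ 0 ℤ.≤_) (sym (recurrence i)) (ℤ.+-mono-≤ (jump-rising i le) earlier)
        where
        earlier : + 0 ℤ.≤ coeff (shifted N Q) i
        earlier with split-< N i
        ... | inj₁ i<N = ℤ.≤-reflexive (sym (coeff-shifted-< Q i<N))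
        ... | inj₂ (j , refl) = subst (+ 0 ℤ.≤_) (sym (coeff-shifted-+ N Q j))
          (rec (ℕ.+-monoˡ-< j 0<N) (ℕ.≤-trans (ℕ.*-monoʳ-≤ 2 (ℕ.m≤n+m j N)) le))

    -- Read backwards, the recurrence is Q_j = Q_(N+j) - jump (N+j), started from Q_j = 0 for large j.
    falling : ∀ fuel j → length Q ≤ fuel + j → z * k ≤ 2 * j → + 0 ℤ.≤ coeff Q j
    falling zero       j len le = ℤ.≤-reflexive (sym (coeff-beyond Q len))
    falling (suc fuel) j len le = subst (+ 0 ℤ.≤_) (sym previous) (ℤ.i≤j⇒0≤j-i (ℤ.≤-trans jump≤0 later))
      where
      previous : coeff Q j ≡ coeff Q (N + j) ℤ.- jump (N + j)
      previous = sym (trans (cong (ℤ._- jump (N + j)) (trans (recurrence (N + j))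
        (cong (λ t → jump (N + j) ℤ.+ t) (coeff-shifted-+ N Q j))))
        (undo (jump (N + j)) (coeff Q j)))
        where
        undo : ∀ a b → a ℤ.+ b ℤ.- a ≡ b
        undo = solve-∀
      later : + 0 ℤ.≤ coeff Q (N + j)
      later = falling fuel (N + j)
        (ℕ.≤-trans len (ℕ.≤-trans (ℕ.≤-reflexive (sym (ℕ.+-suc fuel j)))
          (ℕ.+-monoʳ-≤ fuel (ℕ.+-monoˡ-≤ j 0<N))))
        (ℕ.≤-trans le (ℕ.*-monoʳ-≤ 2 (ℕ.m≤n+m j N)))
      jump≤0 : jump (N + j) ℤ.≤ + 0
      jump≤0 = subst (ℤ._≤ + 0)
        (sym (trans (cong jump (ℕ.+-assoc g N′ j)) (jump-+ (N′ + j))))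
        (ℤ.i≤j⇒i-j≤0 (ℤ.+≤+ (#words-decreasing* z k g (N′ + j)
          (ℕ.≤-trans le (ℕ.*-monoʳ-≤ 2 (ℕ.m≤n+m j N′))))))

  quotient-nonnegative : ∀ i → + 0 ℤ.≤ coeff Q i
  quotient-nonnegative i with ℕ.≤-total (2 * i) (z * k)
  ... | inj₁ le = rising i le
  -- Coefficients vanish from index `length Q` on, so this much fuel reaches the zero tail.
  ... | inj₂ ge = falling (length Q) i (ℕ.m≤m+n (length Q) i) ge

-- Natural coefficients and clearing of denominators

∣_∣ₚ : Poly → List ℕ
∣ p ∣ₚ = map ℤ.∣_∣ p

nonnegative⇒fromℕPoly : ∀ p → (∀ i → + 0 ℤ.≤ coeff p i) → fromℕPoly ∣ p ∣ₚ ≈ₚ p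
nonnegative⇒fromℕPoly []      nonneg i       = refl
nonnegative⇒fromℕPoly (c ∷ p) nonneg zero    = ℤ.0≤i⇒+∣i∣≡i (nonneg 0)
nonnegative⇒fromℕPoly (c ∷ p) nonneg (suc i) = nonnegative⇒fromℕPoly p (λ j → nonneg (suc j)) i

gauss-quotient : ∀ z m → Σ (List ℕ) λ P →
  fromℕPoly P *ₚ 1-q^ (suc (z + m)) ≈ₚ 1-q^ (gcd z (suc m)) *ₚ gauss z (suc m)
gauss-quotient z m = ∣ Q ∣ₚ , λ i → trans
  (*ₚ-cong {fromℕPoly ∣ Q ∣ₚ} {Q} {D} {D}
    (nonnegative⇒fromℕPoly Q (quotient-nonnegative z (suc m) g N′ (subst (0 <_) (sym N≡) ℕ.z<s) Q
      (subst (λ n → Q *ₚ 1-q^ n ≈ₚ 1-q^ g *ₚ G) (sym N≡) Q-eq)))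
    (λ _ → refl) i)
  (Q-eq i)
  where
  D = 1-q^ (suc (z + m))
  G = gauss z (suc m)
  g = gcd z (suc m)
  ones-cleared : Cleared D G (suc m)
  ones-cleared = gauss z m , λ i → sym (gauss-absorption z m i)
  total-cleared : Cleared D G (z + suc m)
  total-cleared = G , λ i → trans (*ₚ-comm G D i) (cong (λ n → coeff (1-q^ n *ₚ G) i) (sym (ℕ.+-suc z m)))
  cleared : Cleared D G g
  -- Only z + (m+1) and m+1 are cleared directly; their difference gives z.
  cleared = cleared-gcd D G z (suc m) (cleared-cancel D G z (suc m) total-cleared ones-cleared) ones-cleared
  Q = proj₁ cleared
  Q-eq = proj₂ cleared
  N′ = suc (z + m) ℕ.∸ g
  N≡ : g + N′ ≡ suc (z + m)
  -- The gcd divides the positive number m+1, hence g ≤ m+1 ≤ z+m+1.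
  N≡ = ℕ.m+[n∸m]≡n (ℕ.≤-trans (∣⇒≤ (gcd[m,n]∣n z (suc m))) (ℕ.s≤s (ℕ.m≤n+m m z)))

-- One P has to satisfy both equations. The second is `gauss-quotient` multiplied by the
-- q-factorials in the denominator of G; the first is then deduced from it.
nonnegative-quotient : ∀ k m → Σ (List ℕ) λ P →
  (fromℕPoly P *ₚ 1-q^ (m + 1) *ₚ qPoch k *ₚ qPoch m ≈ₚ 1-q^ (gcd k (m + 1)) *ₚ qPoch (k + m))
  × (fromℕPoly P *ₚ 1-q^ (k + m + 1) *ₚ qPoch k *ₚ qPoch (m + 1)
       ≈ₚ 1-q^ (gcd k (m + 1)) *ₚ qPoch (k + m + 1))
-- Successors in place of + 1 let `qPoch` unfold by one factor.
nonnegative-quotient k m rewrite ℕ.+-comm m 1 | ℕ.+-comm (k + m) 1 = P , first , second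
  where
  P = proj₁ (gauss-quotient k m)
  p = fromℕPoly P
  γ = 1-q^ (gcd k (suc m))
  D = 1-q^ (suc (k + m))
  G = gauss k (suc m)
  second : p *ₚ D *ₚ qPoch k *ₚ qPoch (suc m) ≈ₚ γ *ₚ qPoch (suc (k + m))
  second = begin
    p *ₚ D *ₚ qPoch k *ₚ qPoch (suc m)
      ≈⟨ *ₚ-cong {p *ₚ D *ₚ qPoch k} {γ *ₚ G *ₚ qPoch k} {qPoch (suc m)} {qPoch (suc m)}
           (*ₚ-cong {p *ₚ D} {γ *ₚ G} {qPoch k} {qPoch k} (proj₂ (gauss-quotient k m)) (λ _ → refl))
           (λ _ → refl) ⟩
    γ *ₚ G *ₚ qPoch k *ₚ qPoch (suc m)    ≈⟨ group-left γ G (qPoch k) (qPoch (suc m)) ⟩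
    γ *ₚ (G *ₚ qPoch k *ₚ qPoch (suc m))
      ≈⟨ *ₚ-congˡ γ {G *ₚ qPoch k *ₚ qPoch (suc m)} {qPoch (k + suc m)} (gauss-qPoch k (suc m)) ⟩
    γ *ₚ qPoch (k + suc m)                ≡⟨ cong (λ n → γ *ₚ qPoch n) (ℕ.+-suc k m) ⟩
    γ *ₚ qPoch (suc (k + m))              ∎
  first : p *ₚ 1-q^ (suc m) *ₚ qPoch k *ₚ qPoch m ≈ₚ γ *ₚ qPoch (k + m)
  -- Multiplied by D the first equation turns into the second: on the left 1 - q^(m+1) completes
  -- `qPoch m` to `qPoch (suc m)`, on the right D completes `qPoch (k + m)`.
  first = 1-q^-cancelʳ (k + m) (p *ₚ 1-q^ (suc m) *ₚ qPoch k *ₚ qPoch m) (γ *ₚ qPoch (k + m)) (begin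
    p *ₚ 1-q^ (suc m) *ₚ qPoch k *ₚ qPoch m *ₚ D  ≈⟨ collect p (1-q^ (suc m)) (qPoch k) (qPoch m) D ⟩
    p *ₚ D *ₚ qPoch k *ₚ qPoch (suc m)            ≈⟨ second ⟩
    γ *ₚ (D *ₚ qPoch (k + m))                     ≈⟨ rotate γ D (qPoch (k + m)) ⟩
    γ *ₚ qPoch (k + m) *ₚ D                       ∎)

theorem3p3 : (a b n : ℕ) → 0 < a → 0 < b → 0 < n →
    Σ (List ℕ) λ P →
    (fromℕPoly P *ₚ 1-q^ (b * n + 1) *ₚ qPoch (a * n) *ₚ qPoch (b * n)
    ≈ₚ 1-q^ (gcd (a * n) (b * n + 1)) *ₚ qPoch (a * n + b * n))
    × (fromℕPoly P *ₚ 1-q^ (a * n + b * n + 1) *ₚ qPoch (a * n) *ₚ qPoch (b * n + 1)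
    ≈ₚ 1-q^ (gcd (a * n) (b * n + 1)) *ₚ qPoch (a * n + b * n + 1))
theorem3p3 a b n _ _ _ = nonnegative-quotient (a * n) (b * n)
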